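{- Let $p$ be a prime, $u\ge0$ and $v\ge1$ integers. Then for every integer $n\ge0$, $$v_p(\#\operatorname{Hom}(C_{p^u},GL_n(\mathbb{F}_{p^v})))\geq v\,\frac{p^u-1}{p^u+1}\binom{n}{2},$$ and equality holds if $n\equiv 0$ or $1\pmod{p^u+1}$.
   Context: $C_m$ is the cyclic group of order $m$, $\mathbb{F}_{p^v}$ the field with $p^v$ elements, $\#\operatorname{Hom}(G,H)$ the number of group homomorphisms from $G$ to $H$, and $v_p$ the $p$-adic valuation. -}

module Defs where

open import Level using (0ℓ)
open import Data.Nat using (ℕ; zero; suc; _^_)
open import Data.Nat.Divisibility using (_∣?_)
open import Data.Fin using (Fin; toℕ; zero; suc)
open import Data.Fin.Properties using (all?; any?) renaming (_≟_ to _≟ᶠ_)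
open import Data.List using (List; []; _∷_; map; concatMap; length; filter; allFin)
open import Data.Product using (∃; Σ; _×_; _,_)
open import Data.Sum using (_⊎_)
open import Relation.Nullary using (Dec; yes; no; ¬_)
open import Relation.Nullary.Decidable using (_×-dec_; _⊎-dec_; _→-dec_; ¬?)
open import Relation.Unary using (Pred; Decidable)
open import Relation.Binary.PropositionalEquality using (_≡_)
open import Algebra.Structures using (IsCommutativeRing)
open import Data.List.Relation.Unary.Any using (Any) renaming (any? to anyL?)
import Data.Nat.Properties as ℕP

-- p-adic valuation: v_p(N) = the largest k ≤ N with p ^ k ∣ N
-- (for N ≥ 1 and p ≥ 2 this is the usual p-adic valuation).

vpFrom : ℕ → ℕ → ℕ → ℕ
vpFrom p N zero = zero
vpFrom p N (suc k) with (p ^ suc k) ∣? N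
... | yes _ = suc k
... | no  _ = vpFrom p N k

vp : ℕ → ℕ → ℕ
vp p N = vpFrom p N N

-- A field structure on the finite set Fin q (equality is ≡).
-- A field with q elements; for q = p ^ v this is F_{p^v}
-- (unique up to isomorphism).

record FieldOn (q : ℕ) : Set where
  field
    _+_ _*_ : Fin q → Fin q → Fin q
    -_      : Fin q → Fin q
    0# 1#   : Fin q
    isCommutativeRing : IsCommutativeRing _≡_ _+_ _*_ -_ 0# 1#
    0≢1     : ¬ (0# ≡ 1#)
    inverse : ∀ x → ¬ (x ≡ 0#) → ∃ λ y → (x * y) ≡ 1#

allFuns : ∀ {A : Set} (n : ℕ) → List A → List (Fin n → A)
allFuns zero    xs = (λ ()) ∷ []
allFuns (suc n) xs =
  concatMap (λ x → map (λ f → λ { zero → x ; (suc i) → f i }) (allFuns n xs)) xs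

count : ∀ {A : Set} {P : Pred A 0ℓ} → Decidable P → List A → ℕ
count P? xs = length (filter P? xs)

module Matrices {q : ℕ} (F : FieldOn q) where
  open FieldOn F

  Mat : ℕ → Set
  Mat n = Fin n → Fin n → Fin q

  sumF : ∀ {n} → (Fin n → Fin q) → Fin q
  sumF {zero}  f = 0#
  sumF {suc n} f = f zero + sumF (λ i → f (suc i))

  _⊗_ : ∀ {n} → Mat n → Mat n → Mat n
  (A ⊗ B) i j = sumF (λ k → A i k * B k j)

  I : ∀ {n} → Mat n
  I i j with i ≟ᶠ j
  ... | yes _ = 1#
  ... | no  _ = 0#

  _≐_ : ∀ {n} → Mat n → Mat n → Set
  A ≐ B = ∀ i j → A i j ≡ B i j

  _≐?_ : ∀ {n} (A B : Mat n) → Dec (A ≐ B)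
  A ≐? B = all? (λ i → all? (λ j → A i j ≟ᶠ B i j))

  allMats : (n : ℕ) → List (Mat n)
  allMats n = allFuns n (allFuns n (allFin q))

  -- A ∈ GL_n(F): there is B with A B = I (which for square matrices over
  -- a field is equivalent to two-sided invertibility).
  IsInvertible : ∀ {n} → Mat n → Set
  IsInvertible {n} A = Any (λ B → (A ⊗ B) ≐ I) (allMats n)

  isInvertible? : ∀ {n} (A : Mat n) → Dec (IsInvertible A)
  isInvertible? A = anyL? (λ B → (A ⊗ B) ≐? I) _

  -- Group homomorphisms C_m → GL_n(F), where C_m = Z/mZ is realised on
  -- Fin m with addition modulo m: for i j k < m, i + j ≡ k (mod m) iff
  -- i + j = k or i + j = k + m.
  AddMod : (m : ℕ) → Fin m → Fin m → Fin m → Set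
  AddMod m i j k = (toℕ i Data.Nat.+ toℕ j ≡ toℕ k)
                 ⊎ (toℕ i Data.Nat.+ toℕ j ≡ toℕ k Data.Nat.+ m)

  addMod? : (m : ℕ) → ∀ i j k → Dec (AddMod m i j k)
  addMod? m i j k = (toℕ i Data.Nat.+ toℕ j ℕP.≟ toℕ k)
               ⊎-dec (toℕ i Data.Nat.+ toℕ j ℕP.≟ toℕ k Data.Nat.+ m)

  IsHom : (m n : ℕ) → (Fin m → Mat n) → Set
  IsHom m n f = (∀ i → IsInvertible (f i))
              × (∀ i j k → AddMod m i j k → f k ≐ (f i ⊗ f j))

  isHom? : (m n : ℕ) → (f : Fin m → Mat n) → Dec (IsHom m n f)
  isHom? m n f = all? (λ i → isInvertible? (f i))
           ×-dec all? (λ i → all? (λ j → all? (λ k →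
                   addMod? m i j k →-dec (f k ≐? (f i ⊗ f j)))))

  numHom : (m n : ℕ) → ℕ
  numHom m n = count (isHom? m n) (allFuns m (allMats n))

{-# OPTIONS --safe #-}
module Submission where

-- Write m = p ^ u and q = p ^ v. In characteristic p, A ^ m = 1 means (A - 1) ^ m = 0, so the number of homomorphisms
-- is the number a(n) of n × n matrices N with N ^ m = 0.
--
-- Let G_j(n) be the number of pairs (N , v) with N ^ m = 0 and N ^ j v = 0, so that G_0(n) = a(n) and
-- G_m(n) = q ^ n a(n). For 1 ≤ i ≤ m the difference G_i(n) - G_{i-1}(n) counts the pairs in which v has order exactly
-- i. Adjoining a row r with r N ^ (i-1) v = 1, moving N ^ (i-1) v to the first basis vector and splitting it off, one
-- dimension at a time, shows that this difference is a unit at p times q ^ (C(i,2) + (i-1)(n-i)) G_{m-i}(n-i).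
--
-- Induction on n then gives (m+1) v_p(G_j(n)) ≥ v ((m-1) C(n,2) + max(0, 2j+1-m) n): summing the differences bounds
-- (q ^ n - 1) a(n), and subtracting them from q ^ n a(n) bounds the other G_j(n). Modulo terms of larger valuation,
-- a(n+1) agrees with G_{m-1}(n), which agrees with - (unit) q ^ (..) a(n-m), so sharpness of the bound for a(n-m)
-- carries over to a(n+1); it holds for a(0) and a(1).

open import Defs
open import Level using (0ℓ)
open import Data.Empty using (⊥-elim)
open import Data.Fin using (Fin; zero; suc; toℕ)
open import Data.Nat using (ℕ; zero; suc)
open import Data.Product using (∃; _×_; _,_; proj₁; proj₂)
open import Data.Sum using (_⊎_; inj₁; inj₂)
open import Data.Unit using (⊤; tt)
open import Function using (_∘_; id)
open import Relation.Binary.PropositionalEquality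
open import Relation.Nullary using (Dec; yes; no; ¬_)
open import Relation.Nullary.Decidable using (_×-dec_; ¬?; map′)
open import Relation.Unary using (Decidable)

-- A cyclic submodule of length below m need not be a direct summand, so pairs (N , v) cannot be
-- counted by choosing complements. The row r is the substitute. Besides pairing to 1 with the last
-- nonzero vector of the chain of v, it carries a condition r N ^ j = 0. At the start j = m and the
-- condition is automatic. Each dimension split off lowers j by one, since passing to the quotient
-- uses up one factor N. After i dimensions a row killed by the power m - i is left over, and
-- transposing it gives G_{m-i}(n-i). A bound on a(n) alone does not reproduce itself. For vectors
-- of order i + 1 over a remaining dimension n, put k = m - 1 - i. If i < k, the power of q can fall
-- short by a term of size (k - i) n, which G_k(n) has to supply; this fixes the slope 2k + 1 - m =
-- k - i. If i > k, the same balance leaves a surplus (i - k) n, which is just the slope of G_i. At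
-- j = m the slope is m + 1, the contribution of q ^ n. All exponents are multiplied by m + 1 to
-- keep them integral.

-- Counting in finite setoids: double counting, fibres, bijections.

module Counting where
  open import Data.Nat using (ℕ; zero; suc; _+_; _*_; _^_)
  open import Data.Nat.Properties hiding (suc-injective)
  open import Algebra.Properties.CommutativeSemigroup +-commutativeSemigroup using (interchange)
  open import Data.Fin.Properties using (all?; suc-injective) renaming (_≟_ to _≟ᶠ_)
  open import Data.List using (List; []; _∷_; _++_; map; concatMap; length; allFin; tabulate)

  private variable
    A B : Set

  ∑ : List A → (A → ℕ) → ℕ
  ∑ []       f = 0
  ∑ (x ∷ xs) f = f x + ∑ xs f

  ∑-cong : ∀ (xs : List A) {f g} → (∀ x → f x ≡ g x) → ∑ xs f ≡ ∑ xs g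
  ∑-cong []       e = refl
  ∑-cong (x ∷ xs) e = cong₂ _+_ (e x) (∑-cong xs e)

  ∑-zero : ∀ (xs : List A) → ∑ xs (λ _ → 0) ≡ 0
  ∑-zero []       = refl
  ∑-zero (x ∷ xs) = ∑-zero xs

  ∑-+ : ∀ (xs : List A) f g → ∑ xs (λ x → f x + g x) ≡ ∑ xs f + ∑ xs g
  ∑-+ []       f g = refl
  ∑-+ (x ∷ xs) f g = trans (cong (f x + g x +_) (∑-+ xs f g)) (interchange (f x) (g x) _ _)

  ∑-*ʳ : ∀ (xs : List A) f k → ∑ xs (λ x → f x * k) ≡ ∑ xs f * k
  ∑-*ʳ []       f k = refl
  ∑-*ʳ (x ∷ xs) f k = trans (cong (f x * k +_) (∑-*ʳ xs f k)) (sym (*-distribʳ-+ k (f x) _))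

  ∑-comm : ∀ (xs : List A) (ys : List B) (f : A → B → ℕ) → ∑ xs (λ x → ∑ ys (f x)) ≡ ∑ ys (λ y → ∑ xs (λ x → f x y))
  ∑-comm []       ys f = sym (∑-zero ys)
  ∑-comm (x ∷ xs) ys f = trans (cong (∑ ys (f x) +_) (∑-comm xs ys f)) (sym (∑-+ ys (f x) _))

  ∑-++ : ∀ (xs ys : List A) f → ∑ (xs ++ ys) f ≡ ∑ xs f + ∑ ys f
  ∑-++ []       ys f = refl
  ∑-++ (x ∷ xs) ys f = trans (cong (f x +_) (∑-++ xs ys f)) (sym (+-assoc (f x) _ _))

  ∑-map : ∀ (h : A → B) xs f → ∑ (map h xs) f ≡ ∑ xs (f ∘ h)
  ∑-map h []       f = refl
  ∑-map h (x ∷ xs) f = cong (f (h x) +_) (∑-map h xs f)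

  ∑-concatMap : ∀ (h : A → List B) xs f → ∑ (concatMap h xs) f ≡ ∑ xs (λ x → ∑ (h x) f)
  ∑-concatMap h []       f = refl
  ∑-concatMap h (x ∷ xs) f = trans (∑-++ (h x) _ f) (cong (∑ (h x) f +_) (∑-concatMap h xs f))

  ind : {P : Set} → Dec P → ℕ
  ind (yes _) = 1
  ind (no  _) = 0

  ind-⇔ : {P Q : Set} (P? : Dec P) (Q? : Dec Q) → (P → Q) → (Q → P) → ind P? ≡ ind Q?
  ind-⇔ (yes p) (yes q) f g = refl
  ind-⇔ (yes p) (no ¬q) f g = ⊥-elim (¬q (f p))
  ind-⇔ (no ¬p) (yes q) f g = ⊥-elim (¬p (g q))
  ind-⇔ (no ¬p) (no ¬q) f g = refl

  ind-× : {P Q : Set} (P? : Dec P) (Q? : Dec Q) → ind (P? ×-dec Q?) ≡ ind P? * ind Q?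
  ind-× (yes p) (yes q) = refl
  ind-× (yes p) (no ¬q) = refl
  ind-× (no ¬p) _       = refl

  count≡∑ : {P : A → Set} (P? : Decidable P) → ∀ xs → count P? xs ≡ ∑ xs (λ x → ind (P? x))
  count≡∑ P? []       = refl
  count≡∑ P? (x ∷ xs) with P? x
  ... | yes _ = cong suc (count≡∑ P? xs)
  ... | no  _ = count≡∑ P? xs

  count-⇔ : {P Q : A → Set} (P? : Decidable P) (Q? : Decidable Q) →
            (∀ x → P x → Q x) → (∀ x → Q x → P x) → ∀ xs → count P? xs ≡ count Q? xs
  count-⇔ P? Q? f g xs =
    trans (count≡∑ P? xs) (trans (∑-cong xs λ x → ind-⇔ (P? x) (Q? x) (f x) (g x)) (sym (count≡∑ Q? xs)))

  count-none : {P : A → Set} (P? : Decidable P) → (∀ x → ¬ P x) → ∀ xs → count P? xs ≡ 0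
  count-none P? ¬p []       = refl
  count-none P? ¬p (x ∷ xs) with P? x
  ... | yes p = ⊥-elim (¬p x p)
  ... | no  _ = count-none P? ¬p xs

  count-all : {P : A → Set} (P? : Decidable P) → (∀ x → P x) → ∀ xs → count P? xs ≡ length xs
  count-all P? p []       = refl
  count-all P? p (x ∷ xs) with P? x
  ... | yes _  = cong suc (count-all P? p xs)
  ... | no ¬px = ⊥-elim (¬px (p x))

  count-split : {P Q : A → Set} (P? : Decidable P) (Q? : Decidable Q) → ∀ xs →
                count P? xs ≡ count (λ x → P? x ×-dec Q? x) xs + count (λ x → P? x ×-dec ¬? (Q? x)) xs
  count-split P? Q? []       = refl
  count-split P? Q? (x ∷ xs) with P? x | Q? x
  ... | yes _ | yes _ = cong suc (count-split P? Q? xs)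
  ... | yes _ | no  _ = trans (cong suc (count-split P? Q? xs)) (sym (+-suc _ _))
  ... | no  _ | _     = count-split P? Q? xs

  -- The combiner `c` is left general because pairing (in `_⊗ᴱ_`) and prepending a value to a
  -- function (in `allFuns`) build their lists by the same `concatMap`.
  count-pairs : ∀ {C : Set} {P : A → Set} {Q : B → Set} {R : C → Set}
                (P? : Decidable P) (Q? : Decidable Q) (R? : Decidable R) (c : A → B → C) →
                (∀ x y → R (c x y) → P x × Q y) → (∀ x y → P x → Q y → R (c x y)) → ∀ xs ys →
                count R? (concatMap (λ x → map (c x) ys) xs) ≡ count P? xs * count Q? ys
  count-pairs P? Q? R? c f g xs ys = begin
    count R? (concatMap (λ x → map (c x) ys) xs)       ≡⟨ count≡∑ R? (concatMap (λ x → map (c x) ys) xs) ⟩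
    ∑ (concatMap (λ x → map (c x) ys) xs) (ind ∘ R?)   ≡⟨ ∑-concatMap (λ x → map (c x) ys) xs _ ⟩
    ∑ xs (λ x → ∑ (map (c x) ys) (ind ∘ R?))           ≡⟨ ∑-cong xs (λ x → trans (∑-map (c x) ys _) (∑-cong ys (step x))) ⟩
    ∑ xs (λ x → ∑ ys (λ y → ind (Q? y) * ind (P? x)))  ≡⟨ ∑-cong xs (λ x → trans (∑-*ʳ ys _ (ind (P? x))) (*-comm _ (ind (P? x)))) ⟩
    ∑ xs (λ x → ind (P? x) * ∑ ys (ind ∘ Q?))          ≡⟨ ∑-*ʳ xs _ _ ⟩
    ∑ xs (ind ∘ P?) * ∑ ys (ind ∘ Q?)                  ≡⟨ cong₂ _*_ (count≡∑ P? xs) (count≡∑ Q? ys) ⟨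
    count P? xs * count Q? ys                          ∎
    where
    open ≡-Reasoning
    step : ∀ x y → ind (R? (c x y)) ≡ ind (Q? y) * ind (P? x)
    step x y = trans (ind-⇔ (R? (c x y)) (Q? y ×-dec P? x) (λ r → proj₂ (f x y r) , proj₁ (f x y r)) (λ (q , p) → g x y p q))
                     (ind-× (Q? y) (P? x))

  double-count : {P : A → Set} {Q : B → Set} {R : A → B → Set}
    (P? : Decidable P) (Q? : Decidable Q) (R? : ∀ a b → Dec (R a b)) (xs : List A) (ys : List B) (k l : ℕ) →
    (∀ {a b} → R a b → P a × Q b) →
    (∀ a → P a → count (R? a) ys ≡ k) → (∀ b → Q b → count (λ a → R? a b) xs ≡ l) →
    count P? xs * k ≡ count Q? ys * l
  double-count {P = P} {Q} P? Q? R? xs ys k l imp f g = begin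
    count P? xs * k                           ≡⟨ cong (_* k) (count≡∑ P? xs) ⟩
    ∑ xs (ind ∘ P?) * k                       ≡⟨ ∑-*ʳ xs _ k ⟨
    ∑ xs (λ a → ind (P? a) * k)               ≡⟨ ∑-cong xs rows ⟨
    ∑ xs (λ a → count (R? a) ys)              ≡⟨ ∑-cong xs (λ a → count≡∑ (R? a) ys) ⟩
    ∑ xs (λ a → ∑ ys λ b → ind (R? a b))      ≡⟨ ∑-comm xs ys _ ⟩
    ∑ ys (λ b → ∑ xs λ a → ind (R? a b))      ≡⟨ ∑-cong ys (λ b → count≡∑ (λ a → R? a b) xs) ⟨
    ∑ ys (λ b → count (λ a → R? a b) xs)      ≡⟨ ∑-cong ys cols ⟩
    ∑ ys (λ b → ind (Q? b) * l)               ≡⟨ ∑-*ʳ ys _ l ⟩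
    ∑ ys (ind ∘ Q?) * l                       ≡⟨ cong (_* l) (count≡∑ Q? ys) ⟨
    count Q? ys * l                           ∎
    where
    open ≡-Reasoning
    rows : ∀ a → count (R? a) ys ≡ ind (P? a) * k
    rows a with P? a
    ... | yes p = trans (f a p) (sym (+-identityʳ k))
    ... | no ¬p = count-none (R? a) (λ b r → ¬p (proj₁ (imp r))) ys
    cols : ∀ b → count (λ a → R? a b) xs ≡ ind (Q? b) * l
    cols b with Q? b
    ... | yes p = trans (g b p) (sym (+-identityʳ l))
    ... | no ¬p = count-none (λ a → R? a b) (λ a r → ¬p (proj₂ (imp r))) xs

  -- A finite setoid: the list meets every class exactly once.
  record Enum : Set₁ where
    infix 4 _≈_ _≈?_
    field
      Carrier : Set
      _≈_     : Carrier → Carrier → Set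
      ≈-refl  : ∀ {x} → x ≈ x
      ≈-sym   : ∀ {x y} → x ≈ y → y ≈ x
      ≈-trans : ∀ {x y z} → x ≈ y → y ≈ z → x ≈ z
      _≈?_    : ∀ x y → Dec (x ≈ y)
      elems   : List Carrier
      once    : ∀ x → count (x ≈?_) elems ≡ 1
  open Enum using (Carrier; elems)

  # : (A : Enum) {P : Carrier A → Set} → Decidable P → ℕ
  # A P? = count P? (elems A)

  card : Enum → ℕ
  card A = length (elems A)

  infixr 2 _⊗ᴱ_
  _⊗ᴱ_ : Enum → Enum → Enum
  A ⊗ᴱ B = record
    { Carrier = Carrier A × Carrier B
    ; _≈_     = λ (a , b) (a′ , b′) → a A.≈ a′ × b B.≈ b′
    ; ≈-refl  = A.≈-refl , B.≈-refl
    ; ≈-sym   = λ (e , f) → A.≈-sym e , B.≈-sym f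
    ; ≈-trans = λ (e , f) (e′ , f′) → A.≈-trans e e′ , B.≈-trans f f′
    ; _≈?_    = λ (a , b) (a′ , b′) → (a A.≈? a′) ×-dec (b B.≈? b′)
    ; elems   = concatMap (λ a → map (a ,_) B.elems) A.elems
    ; once    = λ (a , b) → trans
        (count-pairs (a A.≈?_) (b B.≈?_) _ _,_ (λ _ _ e → e) (λ _ _ e f → e , f) A.elems B.elems)
        (cong₂ _*_ (A.once a) (B.once b))
    }
    where module A = Enum A
          module B = Enum B

  #-× : ∀ (A B : Enum) {P : Carrier A → Set} {Q : Carrier B → Set} (P? : Decidable P) (Q? : Decidable Q) →
        # (A ⊗ᴱ B) (λ (a , b) → P? a ×-dec Q? b) ≡ # A P? * # B Q?
  #-× A B P? Q? = count-pairs P? Q? _ _,_ (λ _ _ e → e) (λ _ _ e f → e , f) (elems A) (elems B)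

  -- Stated for an injective `f` instead of `id` so that the induction can pass to `f ∘ suc`.
  count-tabulate : ∀ {k n} (f : Fin k → Fin n) → (∀ {i j} → f i ≡ f j → i ≡ j) →
                   ∀ j → count (f j ≟ᶠ_) (tabulate f) ≡ 1
  count-tabulate f inj zero with f zero ≟ᶠ f zero
  ... | yes _ = cong suc (absent (f ∘ suc) (λ i e → 0≢1+n (cong toℕ (inj e))))
    where
    absent : ∀ {k} (g : Fin k → Fin _) → (∀ i → ¬ f zero ≡ g i) → count (f zero ≟ᶠ_) (tabulate g) ≡ 0
    absent {zero}  g ne = refl
    absent {suc k} g ne with f zero ≟ᶠ g zero
    ... | yes e = ⊥-elim (ne zero e)
    ... | no  _ = absent (g ∘ suc) (ne ∘ suc)
  ... | no ne = ⊥-elim (ne refl)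
  count-tabulate f inj (suc j) with f (suc j) ≟ᶠ f zero
  ... | yes e = ⊥-elim (1+n≢0 (cong toℕ (inj e)))
  ... | no  _ = count-tabulate (f ∘ suc) (λ e → suc-injective (inj e)) j

  finᴱ : ℕ → Enum
  finᴱ n = record
    { Carrier = Fin n ; _≈_ = _≡_ ; ≈-refl = refl ; ≈-sym = sym ; ≈-trans = trans
    ; _≈?_ = _≟ᶠ_ ; elems = allFin n ; once = count-tabulate id id }

  module _ (A : Enum) where
    private module A = Enum A

    infix 4 _≋_
    _≋_ : ∀ {n} → (Fin n → Carrier A) → (Fin n → Carrier A) → Set
    f ≋ g = ∀ i → f i A.≈ g i

    _≋?_ : ∀ {n} (f g : Fin n → Carrier A) → Dec (f ≋ g)
    f ≋? g = all? (λ i → f i A.≈? g i)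

    allFuns-once : ∀ n (f : Fin n → Carrier A) → count (f ≋?_) (allFuns n A.elems) ≡ 1
    allFuns-once zero    f = count-all (f ≋?_) (λ _ ()) ((λ ()) ∷ [])
    allFuns-once (suc n) f = trans
      (count-pairs (f zero A.≈?_) ((f ∘ suc) ≋?_) (f ≋?_) _
        (λ _ _ e → e zero , e ∘ suc) (λ { _ _ e e′ zero → e ; _ _ e e′ (suc i) → e′ i }) A.elems (allFuns n A.elems))
      (cong₂ _*_ (A.once (f zero)) (allFuns-once n (f ∘ suc)))

    length-allFuns : ∀ n → length (allFuns n A.elems) ≡ card A ^ n
    length-allFuns zero    = refl
    length-allFuns (suc n) = begin
      length (allFuns (suc n) A.elems)             ≡⟨ count-all ⊤? _ (allFuns (suc n) A.elems) ⟨
      count ⊤? (allFuns (suc n) A.elems)           ≡⟨ count-pairs ⊤? ⊤? ⊤? _ _ _ A.elems (allFuns n A.elems) ⟩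
      count ⊤? A.elems * count ⊤? (allFuns n A.elems)
        ≡⟨ cong₂ _*_ (count-all ⊤? _ A.elems) (trans (count-all ⊤? _ (allFuns n A.elems)) (length-allFuns n)) ⟩
      card A * card A ^ n                          ∎
      where
      open ≡-Reasoning
      ⊤? : {C : Set} → Decidable {A = C} (λ _ → ⊤)
      ⊤? _ = yes tt

  funᴱ : ℕ → Enum → Enum
  funᴱ n A = record
    { Carrier = Fin n → Carrier A ; _≈_ = _≋_ A
    ; ≈-refl = λ _ → A.≈-refl ; ≈-sym = λ e i → A.≈-sym (e i) ; ≈-trans = λ e f i → A.≈-trans (e i) (f i)
    ; _≈?_ = _≋?_ A ; elems = allFuns n A.elems ; once = allFuns-once A n }
    where module A = Enum A

  module _ (A B : Enum) where
    private
      module A = Enum A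
      module B = Enum B

    #-fibres : {P : A.Carrier → Set} {Q : B.Carrier → Set} (P? : Decidable P) (Q? : Decidable Q)
               (φ : A.Carrier → B.Carrier) (k : ℕ) →
               (∀ {b b′} → b B.≈ b′ → Q b → Q b′) → (∀ {a} → P a → Q (φ a)) →
               (∀ b → Q b → # A (λ a → P? a ×-dec (φ a B.≈? b)) ≡ k) →
               # A P? ≡ # B Q? * k
    #-fibres P? Q? φ k resp pq fib = trans (sym (*-identityʳ _))
      -- Relate `a` to `b` when `P a` holds and `φ a ≈ b`: each such `a` meets one class, each `b`
      -- in `Q` meets `k` elements.
      (double-count P? Q? (λ a b → P? a ×-dec (φ a B.≈? b)) A.elems B.elems 1 k
        (λ (p , e) → p , resp e (pq p))
        (λ a p → trans (count-⇔ _ (φ a B.≈?_) (λ _ → proj₂) (λ _ e → p , e) B.elems) (B.once (φ a)))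
        fib)

    #-bij : {P : A.Carrier → Set} {Q : B.Carrier → Set} (P? : Decidable P) (Q? : Decidable Q)
            (φ : A.Carrier → B.Carrier) (ψ : B.Carrier → A.Carrier) →
            (∀ {a a′} → a A.≈ a′ → P a → P a′) → (∀ {b b′} → b B.≈ b′ → Q b → Q b′) →
            (∀ {a a′} → a A.≈ a′ → φ a B.≈ φ a′) → (∀ {b b′} → b B.≈ b′ → ψ b A.≈ ψ b′) →
            (∀ {a} → P a → Q (φ a)) → (∀ {b} → Q b → P (ψ b)) →
            (∀ {a} → P a → ψ (φ a) A.≈ a) → (∀ {b} → Q b → φ (ψ b) B.≈ b) →
            # A P? ≡ # B Q?
    #-bij P? Q? φ ψ Presp Qresp φ-cong ψ-cong pq qp ψφ φψ = trans
      (#-fibres P? Q? φ 1 Qresp pq λ b q → trans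
        -- The fibre of `φ` over `b` is the single class of `ψ b`, so the maps need to be inverse
        -- only on `P` and `Q`.
        (count-⇔ _ (ψ b A.≈?_)
          (λ a (p , e) → A.≈-trans (ψ-cong (B.≈-sym e)) (ψφ p))
          (λ a e → Presp e (qp q) , B.≈-trans (φ-cong (A.≈-sym e)) (φψ q)) A.elems)
        (A.once (ψ b)))
      (*-identityʳ _)

    #-dependent : {P : A.Carrier → B.Carrier → Set} {Q : A.Carrier → Set}
                  (P? : ∀ a b → Dec (P a b)) (Q? : Decidable Q) (k : ℕ) →
                  (∀ {a b} → P a b → Q a) → (∀ a → Q a → # B (P? a) ≡ k) →
                  # (A ⊗ᴱ B) (λ (a , b) → P? a b) ≡ # A Q? * k
    #-dependent P? Q? k pq fib = begin
      count P?′ (concatMap (λ a → map (a ,_) B.elems) A.elems)       ≡⟨ count≡∑ P?′ (elems (A ⊗ᴱ B)) ⟩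
      ∑ (elems (A ⊗ᴱ B)) (ind ∘ P?′)                                 ≡⟨ ∑-concatMap (λ a → map (a ,_) B.elems) A.elems _ ⟩
      ∑ A.elems (λ a → ∑ (map (a ,_) B.elems) (ind ∘ P?′))           ≡⟨ ∑-cong A.elems rows ⟩
      ∑ A.elems (λ a → ind (Q? a) * k)                               ≡⟨ ∑-*ʳ A.elems _ k ⟩
      ∑ A.elems (ind ∘ Q?) * k                                       ≡⟨ cong (_* k) (count≡∑ Q? A.elems) ⟨
      # A Q? * k                                                     ∎
      where
      open ≡-Reasoning
      P?′ = λ (a , b) → P? a b
      rows : ∀ a → ∑ (map (a ,_) B.elems) (ind ∘ P?′) ≡ ind (Q? a) * k
      rows a with ∑-map (a ,_) B.elems (ind ∘ P?′) | Q? a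
      ... | e | yes q = trans e (trans (sym (count≡∑ (P? a) B.elems)) (trans (fib a q) (sym (+-identityʳ k))))
      ... | e | no ¬q = trans e (trans (sym (count≡∑ (P? a) B.elems)) (count-none (P? a) (λ b p → ¬q (pq p)) B.elems))

-- Matrix algebra over a finite field and transitivity of the general linear group on nonzero
-- vectors.

module MatrixAlgebra {q : ℕ} (F : FieldOn q) where
  open import Data.Fin.Properties using (all?; ¬∀⟶∃¬) renaming (_≟_ to _≟ᶠ_)
  open import Relation.Binary using (Setoid)
  import Relation.Binary.Reasoning.Setoid
  open import Algebra.Bundles using (CommutativeRing; Ring)

  open FieldOn F using (isCommutativeRing; 0≢1; inverse) public
  fieldRing : CommutativeRing 0ℓ 0ℓ
  fieldRing = record { isCommutativeRing = isCommutativeRing }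
  open CommutativeRing fieldRing
    using (_+_; _*_; -_; 0#; 1#; +-identityˡ; +-identityʳ; +-assoc; +-comm; *-assoc; *-comm; *-identityˡ; *-identityʳ;
           zeroˡ; zeroʳ; distribˡ; distribʳ; -‿inverseˡ; -‿inverseʳ)
  open Matrices F using (sumF; I)
  open import Algebra.Properties.Ring (CommutativeRing.ring fieldRing) using (-‿distribˡ-*; -‿+-comm; -0#≈0#)
  open import Algebra.Properties.CommutativeSemigroup (CommutativeRing.+-commutativeSemigroup fieldRing) using (interchange)

  -- Rectangular matrices: columns are M n 1 and rows are M 1 n.
  M : ℕ → ℕ → Set
  M a b = Fin a → Fin b → Fin q

  private variable
    a b c d n : ℕ

  infix 4 _≐_ _≐?_
  -- A record and not a bare function type, so that the two matrices can be recovered from the type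
  -- of a proof.
  record _≐_ (A B : M a b) : Set where
    constructor entrywise
    field at : ∀ i j → A i j ≡ B i j
  open _≐_ public

  _≐?_ : (A B : M a b) → Dec (A ≐ B)
  A ≐? B = map′ entrywise at (all? (λ i → all? (λ j → A i j ≟ᶠ B i j)))

  ≐-refl : {A : M a b} → A ≐ A
  ≐-refl .at i j = refl

  ≐-sym : {A B : M a b} → A ≐ B → B ≐ A
  ≐-sym e .at i j = sym (at e i j)

  ≐-trans : {A B C : M a b} → A ≐ B → B ≐ C → A ≐ C
  ≐-trans e f .at i j = trans (at e i j) (at f i j)

  ≐-setoid : ℕ → ℕ → Setoid 0ℓ 0ℓ
  ≐-setoid a b = record
    { Carrier = M a b ; _≈_ = _≐_
    ; isEquivalence = record { refl = ≐-refl ; sym = ≐-sym ; trans = ≐-trans } }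
  module ≐-Reasoning {a b} = Relation.Binary.Reasoning.Setoid (≐-setoid a b)
  open ≐-Reasoning

  sumF-cong : ∀ {n} {f g : Fin n → Fin q} → (∀ i → f i ≡ g i) → sumF f ≡ sumF g
  sumF-cong {zero}  e = refl
  sumF-cong {suc n} e = cong₂ _+_ (e zero) (sumF-cong (e ∘ suc))

  sumF-zero : ∀ n → sumF {n} (λ _ → 0#) ≡ 0#
  sumF-zero zero    = refl
  sumF-zero (suc n) = trans (+-identityˡ _) (sumF-zero n)

  sumF-+ : ∀ {n} (f g : Fin n → Fin q) → sumF (λ i → f i + g i) ≡ sumF f + sumF g
  sumF-+ {zero}  f g = sym (+-identityˡ 0#)
  sumF-+ {suc n} f g = trans (cong (f zero + g zero +_) (sumF-+ (f ∘ suc) (g ∘ suc)))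
                             (interchange (f zero) (g zero) (sumF (f ∘ suc)) (sumF (g ∘ suc)))

  *-sumF : ∀ {n} x (f : Fin n → Fin q) → x * sumF f ≡ sumF (λ i → x * f i)
  *-sumF {zero}  x f = zeroʳ x
  *-sumF {suc n} x f = trans (distribˡ x (f zero) (sumF (f ∘ suc))) (cong (x * f zero +_) (*-sumF x (f ∘ suc)))

  sumF-* : ∀ {n} x (f : Fin n → Fin q) → sumF f * x ≡ sumF (λ i → f i * x)
  sumF-* {zero}  x f = zeroˡ x
  sumF-* {suc n} x f = trans (distribʳ x (f zero) (sumF (f ∘ suc))) (cong (f zero * x +_) (sumF-* x (f ∘ suc)))

  sumF-comm : ∀ {m n} (f : Fin m → Fin n → Fin q) →
              sumF (λ i → sumF (f i)) ≡ sumF (λ j → sumF (λ i → f i j))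
  sumF-comm {zero}  {n} f = sym (sumF-zero n)
  sumF-comm {suc m} {n} f = trans (cong (sumF (f zero) +_) (sumF-comm (λ i → f (suc i))))
                                  (sym (sumF-+ (f zero) (λ j → sumF (λ i → f (suc i) j))))

  sumF-neg : ∀ {n} (f : Fin n → Fin q) → sumF (λ j → - f j) ≡ - sumF f
  sumF-neg {zero}  f = sym -0#≈0#
  sumF-neg {suc n} f = trans (cong (- f zero +_) (sumF-neg (f ∘ suc))) (-‿+-comm (f zero) (sumF (f ∘ suc)))

  infixl 7 _∙_
  infixl 6 _⊕_ _⊖_
  infix  9 ⊝_ _ᵀ

  -- Opacity keeps the operations injective for unification.
  opaque
    _∙_ : M a b → M b c → M a c
    (A ∙ B) i k = sumF (λ j → A i j * B j k)

    _⊕_ : M a b → M a b → M a b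
    (A ⊕ B) i j = A i j + B i j

    ⊝_ : M a b → M a b
    (⊝ A) i j = - A i j

    𝟎 : M a b
    𝟎 _ _ = 0#

    𝟏 : M n n
    𝟏 = I

    _ᵀ : M a b → M b a
    (A ᵀ) i j = A j i

  _⊖_ : M a b → M a b → M a b
  A ⊖ B = A ⊕ ⊝ B

  opaque
    unfolding _∙_

    ∙-cong : {A A′ : M a b} {B B′ : M b c} → A ≐ A′ → B ≐ B′ → A ∙ B ≐ A′ ∙ B′
    ∙-cong e f .at i k = sumF-cong (λ j → cong₂ _*_ (at e i j) (at f j k))

    ∙-assoc : (A : M a b) (B : M b c) (C : M c d) → A ∙ B ∙ C ≐ A ∙ (B ∙ C)
    ∙-assoc A B C .at i l = trans (sumF-cong (λ k → sumF-* (C k l) (λ j → A i j * B j k)))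
      (trans (sumF-comm (λ k j → A i j * B j k * C k l))
      (sumF-cong (λ j → trans (sumF-cong (λ k → *-assoc (A i j) (B j k) (C k l))) (sym (*-sumF (A i j) (λ k → B j k * C k l))))))

    𝟏-suc : (i j : Fin n) → 𝟏 (suc i) (suc j) ≡ 𝟏 i j
    𝟏-suc i j with i ≟ᶠ j
    ... | yes _ = refl
    ... | no  _ = refl

    𝟏-sym : (i j : Fin n) → 𝟏 i j ≡ 𝟏 j i
    𝟏-sym i j with i ≟ᶠ j | j ≟ᶠ i
    ... | yes _ | yes _ = refl
    ... | yes e | no ne = ⊥-elim (ne (sym e))
    ... | no ne | yes e = ⊥-elim (ne (sym e))
    ... | no _  | no _  = refl

    sumF-δˡ : ∀ {n} (i : Fin n) (f : Fin n → Fin q) → sumF (λ j → 𝟏 i j * f j) ≡ f i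
    sumF-δˡ {suc n} zero f = trans (cong₂ _+_ (*-identityˡ (f zero)) (trans (sumF-cong (λ j → zeroˡ (f (suc j)))) (sumF-zero n))) (+-identityʳ (f zero))
    sumF-δˡ {suc n} (suc i) f = trans (cong₂ _+_ (zeroˡ (f zero)) (sumF-cong (λ j → cong (_* f (suc j)) (𝟏-suc i j))))
      (trans (+-identityˡ _) (sumF-δˡ i (f ∘ suc)))

    ∙-identityˡ : (A : M a b) → 𝟏 ∙ A ≐ A
    ∙-identityˡ A .at i k = sumF-δˡ i (λ j → A j k)

    ∙-identityʳ : (A : M a b) → A ∙ 𝟏 ≐ A
    ∙-identityʳ A .at i k = trans (sumF-cong (λ j → trans (*-comm (A i j) (𝟏 j k)) (cong (_* A i j) (𝟏-sym j k)))) (sumF-δˡ k (A i))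

    ∙-zeroˡ : (B : M b c) → 𝟎 {a} ∙ B ≐ 𝟎
    ∙-zeroˡ {b = b} B .at i k = trans (sumF-cong (λ j → zeroˡ (B j k))) (sumF-zero b)

    ∙-zeroʳ : (A : M a b) → A ∙ 𝟎 {b} {c} ≐ 𝟎
    ∙-zeroʳ {b = b} A .at i k = trans (sumF-cong (λ j → zeroʳ (A i j))) (sumF-zero b)

    ∙-distribˡ : (A : M a b) (B C : M b c) → A ∙ (B ⊕ C) ≐ A ∙ B ⊕ A ∙ C
    ∙-distribˡ A B C .at i k = trans (sumF-cong (λ j → distribˡ (A i j) (B j k) (C j k))) (sumF-+ (λ j → A i j * B j k) (λ j → A i j * C j k))

    ∙-distribʳ : (C : M b c) (A B : M a b) → (A ⊕ B) ∙ C ≐ A ∙ C ⊕ B ∙ C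
    ∙-distribʳ C A B .at i k = trans (sumF-cong (λ j → distribʳ (C j k) (A i j) (B i j))) (sumF-+ (λ j → A i j * C j k) (λ j → B i j * C j k))

    ⊝-∙ : (A : M a b) (B : M b c) → ⊝ A ∙ B ≐ ⊝ (A ∙ B)
    ⊝-∙ A B .at i k = trans (sumF-cong (λ j → sym (-‿distribˡ-* (A i j) (B j k)))) (sumF-neg (λ j → A i j * B j k))

    ⊕-cong : {A A′ B B′ : M a b} → A ≐ A′ → B ≐ B′ → A ⊕ B ≐ A′ ⊕ B′
    ⊕-cong e f .at i j = cong₂ _+_ (at e i j) (at f i j)

    ⊝-cong : {A B : M a b} → A ≐ B → ⊝ A ≐ ⊝ B
    ⊝-cong e .at i j = cong -_ (at e i j)

    ⊕-assoc : (A B C : M a b) → A ⊕ B ⊕ C ≐ A ⊕ (B ⊕ C)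
    ⊕-assoc A B C .at i j = +-assoc (A i j) (B i j) (C i j)

    ⊕-comm : (A B : M a b) → A ⊕ B ≐ B ⊕ A
    ⊕-comm A B .at i j = +-comm (A i j) (B i j)

    ⊕-identityˡ : (A : M a b) → 𝟎 ⊕ A ≐ A
    ⊕-identityˡ A .at i j = +-identityˡ (A i j)

    ⊕-identityʳ : (A : M a b) → A ⊕ 𝟎 ≐ A
    ⊕-identityʳ A .at i j = +-identityʳ (A i j)

    ⊝-inverseˡ : (A : M a b) → ⊝ A ⊕ A ≐ 𝟎
    ⊝-inverseˡ A .at i j = -‿inverseˡ (A i j)

    ⊝-inverseʳ : (A : M a b) → A ⊕ ⊝ A ≐ 𝟎
    ⊝-inverseʳ A .at i j = -‿inverseʳ (A i j)

    ∙-ᵀ : (A : M a b) (B : M b c) → (A ∙ B) ᵀ ≐ B ᵀ ∙ A ᵀ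
    ∙-ᵀ A B .at i k = sumF-cong (λ j → *-comm (A k j) (B j i))

    𝟎-ᵀ : 𝟎 {a} {b} ᵀ ≐ 𝟎
    𝟎-ᵀ .at i j = refl

    𝟏-ᵀ : 𝟏 {n} ᵀ ≐ 𝟏
    𝟏-ᵀ .at i j = 𝟏-sym j i

    ᵀ-involutive : (A : M a b) → A ᵀ ᵀ ≐ A
    ᵀ-involutive A .at i j = refl

    ᵀ-cong : {A B : M a b} → A ≐ B → A ᵀ ≐ B ᵀ
    ᵀ-cong e .at i j = at e j i

    𝟏₁≢𝟎 : ¬ 𝟏 {1} ≐ 𝟎
    𝟏₁≢𝟎 e = 0≢1 (sym (at e zero zero))

  M₀≐𝟎 : (A : M 0 b) → A ≐ 𝟎
  M₀≐𝟎 A .at ()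

  ∙-congˡ : (A : M a b) {B B′ : M b c} → B ≐ B′ → A ∙ B ≐ A ∙ B′
  ∙-congˡ A = ∙-cong (≐-refl {A = A})

  ∙-congʳ : {A A′ : M a b} (B : M b c) → A ≐ A′ → A ∙ B ≐ A′ ∙ B
  ∙-congʳ B e = ∙-cong e (≐-refl {A = B})

  ∙-empty : (A : M a 0) (B : M 0 b) → A ∙ B ≐ 𝟎
  ∙-empty A B = ≐-trans (∙-congˡ A (M₀≐𝟎 B)) (∙-zeroʳ A)

  ⊖⊕-cancel : (A B : M a b) → A ⊖ B ⊕ B ≐ A
  ⊖⊕-cancel A B = ≐-trans (⊕-assoc A (⊝ B) B) (≐-trans (⊕-cong ≐-refl (⊝-inverseˡ B)) (⊕-identityʳ A))

  ⊕⊖-cancel : (A B : M a b) → A ⊕ B ⊖ B ≐ A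
  ⊕⊖-cancel A B = ≐-trans (⊕-assoc A B (⊝ B)) (≐-trans (⊕-cong ≐-refl (⊝-inverseʳ B)) (⊕-identityʳ A))

  matrixRing : ℕ → Ring 0ℓ 0ℓ
  matrixRing n = record
    { Carrier = M n n ; _≈_ = _≐_ ; _+_ = _⊕_ ; _*_ = _∙_ ; -_ = ⊝_ ; 0# = 𝟎 ; 1# = 𝟏
    ; isRing = record
      { +-isAbelianGroup = record
        { isGroup = record
          { isMonoid = record
            { isSemigroup = record
              { isMagma = record { isEquivalence = Setoid.isEquivalence (≐-setoid n n) ; ∙-cong = ⊕-cong }
              ; assoc = ⊕-assoc }
            ; identity = ⊕-identityˡ , ⊕-identityʳ }
          ; inverse = ⊝-inverseˡ , ⊝-inverseʳ
          ; ⁻¹-cong = ⊝-cong }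
        ; comm = ⊕-comm }
      ; *-cong = ∙-cong
      ; *-assoc = ∙-assoc
      ; *-identity = ∙-identityˡ , ∙-identityʳ
      ; distrib = ∙-distribˡ , ∙-distribʳ } }

  module _ {n : ℕ} where
    open import Algebra.Properties.Semiring.Exp (Ring.semiring (matrixRing n)) public
      using (_^_; ^-cong; ^-congˡ; ^-homo-*; ^-assocʳ)

  ^-sucʳ : (N : M n n) (k : ℕ) → N ^ suc k ≐ N ^ k ∙ N
  ^-sucʳ N zero    = ≐-trans (∙-identityʳ N) (≐-sym (∙-identityˡ N))
  ^-sucʳ N (suc k) = ≐-trans (∙-congˡ N (^-sucʳ N k)) (≐-sym (∙-assoc N (N ^ k) N))

  infixr 5 _∥_
  infixr 4 _⫽_

  opaque
    unfolding _∙_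

    _∥_ : M a 1 → M a b → M a (suc b)
    (A ∥ B) i zero    = A i zero
    (A ∥ B) i (suc j) = B i j

    _⫽_ : M 1 b → M a b → M (suc a) b
    (A ⫽ B) zero    j = A zero j
    (A ⫽ B) (suc i) j = B i j

    firstCol : M a (suc b) → M a 1
    firstCol A i _ = A i zero

    restCols : M a (suc b) → M a b
    restCols A i j = A i (suc j)

    firstRow : M (suc a) b → M 1 b
    firstRow A _ j = A zero j

    restRows : M (suc a) b → M a b
    restRows A i j = A (suc i) j

    scalar : Fin q → M 1 1
    scalar x _ _ = x

    ∥-cong : {A A′ : M a 1} {B B′ : M a b} → A ≐ A′ → B ≐ B′ → A ∥ B ≐ A′ ∥ B′
    ∥-cong e f .at i zero    = at e i zero
    ∥-cong e f .at i (suc j) = at f i j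

    ⫽-cong : {A A′ : M 1 b} {B B′ : M a b} → A ≐ A′ → B ≐ B′ → (A ⫽ B) ≐ (A′ ⫽ B′)
    ⫽-cong e f .at zero    j = at e zero j
    ⫽-cong e f .at (suc i) j = at f i j

    restCols-cong : {A B : M a (suc b)} → A ≐ B → restCols A ≐ restCols B
    restCols-cong e .at i j = at e i (suc j)

    firstRow-cong : {A B : M (suc a) b} → A ≐ B → firstRow A ≐ firstRow B
    firstRow-cong e .at i j = at e zero j

    restRows-cong : {A B : M (suc a) b} → A ≐ B → restRows A ≐ restRows B
    restRows-cong e .at i j = at e (suc i) j

    restCols-∥ : (A : M a 1) (B : M a b) → restCols (A ∥ B) ≐ B
    restCols-∥ A B .at i j = refl

    firstRow-⫽ : (A : M 1 b) (B : M a b) → firstRow (A ⫽ B) ≐ A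
    firstRow-⫽ A B .at zero j = refl

    restRows-⫽ : (A : M 1 b) (B : M a b) → restRows (A ⫽ B) ≐ B
    restRows-⫽ A B .at i j = refl

    ∥-η : (A : M a (suc b)) → firstCol A ∥ restCols A ≐ A
    ∥-η A .at i zero    = refl
    ∥-η A .at i (suc j) = refl

    ⫽-η : (A : M (suc a) b) → (firstRow A ⫽ restRows A) ≐ A
    ⫽-η A .at zero    j = refl
    ⫽-η A .at (suc i) j = refl

    ⫽-∙ : (A : M 1 b) (B : M a b) (C : M b c) → (A ⫽ B) ∙ C ≐ (A ∙ C ⫽ B ∙ C)
    ⫽-∙ A B C .at zero    j = refl
    ⫽-∙ A B C .at (suc i) j = refl

    ∙-∥ : (C : M a b) (A : M b 1) (B : M b c) → C ∙ (A ∥ B) ≐ C ∙ A ∥ C ∙ B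
    ∙-∥ C A B .at i zero    = refl
    ∙-∥ C A B .at i (suc j) = refl

    ∥-∙-⫽ : (A : M a 1) (B : M a b) (C : M 1 c) (D : M b c) → (A ∥ B) ∙ (C ⫽ D) ≐ A ∙ C ⊕ B ∙ D
    ∥-∙-⫽ A B C D .at i j = cong (_+ sumF (λ k → B i k * D k j)) (sym (+-identityʳ (A i zero * C zero j)))

    ∥-⊕ : (A C : M a 1) (B D : M a b) → (A ∥ B) ⊕ (C ∥ D) ≐ A ⊕ C ∥ B ⊕ D
    ∥-⊕ A C B D .at i zero    = refl
    ∥-⊕ A C B D .at i (suc j) = refl

    𝟎-∥ : 𝟎 {a} {1} ∥ 𝟎 {a} {b} ≐ 𝟎
    𝟎-∥ .at i zero    = refl
    𝟎-∥ .at i (suc j) = refl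

    𝟎-⫽ : (𝟎 {1} {b} ⫽ 𝟎 {a} {b}) ≐ 𝟎
    𝟎-⫽ .at zero    j = refl
    𝟎-⫽ .at (suc i) j = refl

    𝟏-block : 𝟏 {suc n} ≐ (𝟏 ∥ 𝟎 ⫽ 𝟎 ∥ 𝟏)
    𝟏-block .at zero    zero    = refl
    𝟏-block .at zero    (suc j) = refl
    𝟏-block .at (suc i) zero    = refl
    𝟏-block .at (suc i) (suc j) = 𝟏-suc i j

    scalar-inverse : ∀ {x y} → x * y ≡ 1# → scalar x ∙ scalar y ≐ 𝟏
    scalar-inverse e .at zero zero = trans (+-identityʳ _) e

    scalar-η : (A : M 1 1) → scalar (A zero zero) ≐ A
    scalar-η A .at zero zero = refl

    unit-row-∙ : (k : Fin n) (w : M n 1) → (λ _ → 𝟏 k) ∙ w ≐ scalar (w k zero)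
    unit-row-∙ k w .at zero zero = at (∙-identityˡ w) k zero

    ≢𝟎⇒entry≢0 : (w : M n 1) → ¬ w ≐ 𝟎 → ∃ λ k → ¬ w k zero ≡ 0#
    ≢𝟎⇒entry≢0 {n} w w≢𝟎 = ¬∀⟶∃¬ n _ (λ k → w k zero ≟ᶠ 0#) (λ all0 → w≢𝟎 (entrywise λ { k zero → all0 k }))

  block-∙ : (A : M 1 1) (B : M 1 b) (C : M a 1) (D : M a b) (A′ : M 1 1) (B′ : M 1 c) (C′ : M b 1) (D′ : M b c) →
            (A ∥ B ⫽ C ∥ D) ∙ (A′ ∥ B′ ⫽ C′ ∥ D′)
            ≐ ((A ∙ A′ ⊕ B ∙ C′ ∥ A ∙ B′ ⊕ B ∙ D′) ⫽ (C ∙ A′ ⊕ D ∙ C′ ∥ C ∙ B′ ⊕ D ∙ D′))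
  block-∙ A B C D A′ B′ C′ D′ = ≐-trans (⫽-∙ (A ∥ B) (C ∥ D) _) (⫽-cong (half A B) (half C D))
    where
    half : ∀ {k} (A : M k 1) (B : M k _) →
           (A ∥ B) ∙ (A′ ∥ B′ ⫽ C′ ∥ D′) ≐ A ∙ A′ ⊕ B ∙ C′ ∥ A ∙ B′ ⊕ B ∙ D′
    half A B = begin
      (A ∥ B) ∙ (A′ ∥ B′ ⫽ C′ ∥ D′)                    ≈⟨ ∥-∙-⫽ A B (A′ ∥ B′) (C′ ∥ D′) ⟩
      A ∙ (A′ ∥ B′) ⊕ B ∙ (C′ ∥ D′)                    ≈⟨ ⊕-cong (∙-∥ A A′ B′) (∙-∥ B C′ D′) ⟩
      (A ∙ A′ ∥ A ∙ B′) ⊕ (B ∙ C′ ∥ B ∙ D′)            ≈⟨ ∥-⊕ (A ∙ A′) (B ∙ C′) (A ∙ B′) (B ∙ D′) ⟩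
      A ∙ A′ ⊕ B ∙ C′ ∥ A ∙ B′ ⊕ B ∙ D′                ∎

  -- The first standard basis vector, the normal form of a nonzero column.
  ε : M (suc n) 1
  ε = 𝟏 ⫽ 𝟎

  ∥-∙-ε : (A : M a 1) (B : M a b) → (A ∥ B) ∙ ε ≐ A
  ∥-∙-ε A B = begin
    (A ∥ B) ∙ ε       ≈⟨ ∥-∙-⫽ A B 𝟏 𝟎 ⟩
    A ∙ 𝟏 ⊕ B ∙ 𝟎     ≈⟨ ⊕-cong (∙-identityʳ A) (∙-zeroʳ B) ⟩
    A ⊕ 𝟎             ≈⟨ ⊕-identityʳ A ⟩
    A                 ∎

  ∙-ε : (A : M a (suc b)) → A ∙ ε ≐ firstCol A
  ∙-ε A = ≐-trans (∙-congʳ ε (≐-sym (∥-η A))) (∥-∙-ε (firstCol A) (restCols A))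

  record Invertible {n} (g : M n n) : Set where
    field
      inv  : M n n
      invʳ : g ∙ inv ≐ 𝟏
      invˡ : inv ∙ g ≐ 𝟏

  ∙-invertible : {g h : M n n} → Invertible g → Invertible h → Invertible (g ∙ h)
  ∙-invertible {g = g} {h} G H = record
    { inv = H.inv ∙ G.inv ; invʳ = cancel g h H.inv G.inv H.invʳ G.invʳ ; invˡ = cancel H.inv G.inv g h G.invˡ H.invˡ }
    where
    module G = Invertible G
    module H = Invertible H
    cancel : (a b c d : M _ _) → b ∙ c ≐ 𝟏 → a ∙ d ≐ 𝟏 → a ∙ b ∙ (c ∙ d) ≐ 𝟏
    cancel a b c d e f = begin
      a ∙ b ∙ (c ∙ d)     ≈⟨ ∙-assoc a b (c ∙ d) ⟩
      a ∙ (b ∙ (c ∙ d))   ≈⟨ ∙-congˡ a (∙-assoc b c d) ⟨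
      a ∙ (b ∙ c ∙ d)     ≈⟨ ∙-congˡ a (∙-congʳ d e) ⟩
      a ∙ (𝟏 ∙ d)         ≈⟨ ∙-congˡ a (∙-identityˡ d) ⟩
      a ∙ d               ≈⟨ f ⟩
      𝟏                   ∎

  -- Its first column is `s` over `w` and its other columns are standard, so for invertible `s` it
  -- carries `ε` to any vector with first entry `s`.
  lower : M 1 1 → M n 1 → M (suc n) (suc n)
  lower s w = s ∥ 𝟎 ⫽ w ∥ 𝟏

  upper : M 1 n → M (suc n) (suc n)
  upper r = 𝟏 ∥ r ⫽ 𝟎 ∥ 𝟏

  lower-∙ : (s s′ : M 1 1) (w w′ : M n 1) → lower s w ∙ lower s′ w′ ≐ lower (s ∙ s′) (w ∙ s′ ⊕ w′)
  lower-∙ s s′ w w′ = ≐-trans (block-∙ s 𝟎 w 𝟏 s′ 𝟎 w′ 𝟏) (⫽-cong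
    (∥-cong (≐-trans (⊕-cong (≐-refl {A = s ∙ s′}) (∙-zeroˡ w′)) (⊕-identityʳ (s ∙ s′)))
            (≐-trans (⊕-cong (∙-zeroʳ s) (∙-zeroˡ 𝟏)) (⊕-identityʳ 𝟎)))
    (∥-cong (⊕-cong (≐-refl {A = w ∙ s′}) (∙-identityˡ w′))
            (≐-trans (⊕-cong (∙-zeroʳ w) (∙-identityˡ 𝟏)) (⊕-identityˡ 𝟏))))

  upper-∙ : (r r′ : M 1 n) → upper r ∙ upper r′ ≐ upper (r′ ⊕ r)
  upper-∙ r r′ = ≐-trans (block-∙ 𝟏 r 𝟎 𝟏 𝟏 r′ 𝟎 𝟏) (⫽-cong
    (∥-cong (≐-trans (⊕-cong (∙-identityˡ 𝟏) (∙-zeroʳ r)) (⊕-identityʳ 𝟏))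
            (⊕-cong (∙-identityˡ r′) (∙-identityʳ r)))
    (∥-cong (≐-trans (⊕-cong (∙-zeroˡ 𝟏) (∙-zeroʳ 𝟏)) (⊕-identityʳ 𝟎))
            (≐-trans (⊕-cong (∙-zeroˡ r′) (∙-identityˡ 𝟏)) (⊕-identityˡ 𝟏))))

  lower-invertible : (s s′ : M 1 1) (w : M n 1) → s ∙ s′ ≐ 𝟏 → s′ ∙ s ≐ 𝟏 → Invertible (lower s w)
  lower-invertible s s′ w e f = record
    { inv  = lower s′ (⊝ (w ∙ s′))
    ; invʳ = ≐-trans (lower-∙ s s′ w _) (unit e (⊝-inverseʳ (w ∙ s′)))
    ; invˡ = ≐-trans (lower-∙ s′ s _ w) (unit f (begin
        (⊝ (w ∙ s′)) ∙ s ⊕ w   ≈⟨ ⊕-cong (⊝-∙ (w ∙ s′) s) ≐-refl ⟩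
        (⊝ (w ∙ s′ ∙ s)) ⊕ w   ≈⟨ ⊕-cong (⊝-cong (≐-trans (∙-assoc w s′ s) (≐-trans (∙-congˡ w f) (∙-identityʳ w)))) ≐-refl ⟩
        (⊝ w) ⊕ w              ≈⟨ ⊝-inverseˡ w ⟩
        𝟎                      ∎)) }
    where
    unit : ∀ {s w} → s ≐ 𝟏 → w ≐ 𝟎 → lower {n = n} s w ≐ 𝟏
    unit e f = ≐-trans (⫽-cong (∥-cong e ≐-refl) (∥-cong f ≐-refl)) (≐-sym 𝟏-block)

  upper-invertible : (r : M 1 n) → Invertible (upper r)
  upper-invertible r = record
    { inv  = upper (⊝ r)
    ; invʳ = ≐-trans (upper-∙ r (⊝ r)) (unit (⊝-inverseˡ r))
    ; invˡ = ≐-trans (upper-∙ (⊝ r) r) (unit (⊝-inverseʳ r)) }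
    where
    unit : ∀ {r} → r ≐ 𝟎 → upper {n = n} r ≐ 𝟏
    unit e = ≐-trans (⫽-cong (∥-cong ≐-refl e) ≐-refl) (≐-sym 𝟏-block)

  first≢𝟎⇒transport : (w : M (suc n) 1) → ¬ firstRow w ≐ 𝟎 → ∃ λ g → Invertible g × g ∙ ε ≐ w
  first≢𝟎⇒transport w w₀≢𝟎 with ≢𝟎⇒entry≢0 (firstRow w) w₀≢𝟎
  ... | zero , x≢0 with inverse (firstRow w zero zero) x≢0
  ... | y , e = lower (firstRow w) (restRows w)
    , lower-invertible (firstRow w) (scalar y) (restRows w)
        (≐-trans (∙-congʳ _ (≐-sym (scalar-η _))) (scalar-inverse e))
        (≐-trans (∙-congˡ _ (≐-sym (scalar-η _))) (scalar-inverse (trans (*-comm y _) e)))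
    , (begin
      lower (firstRow w) (restRows w) ∙ ε                    ≈⟨ ⫽-∙ (firstRow w ∥ 𝟎) (restRows w ∥ 𝟏) ε ⟩
      ((firstRow w ∥ 𝟎) ∙ ε ⫽ (restRows w ∥ 𝟏) ∙ ε)          ≈⟨ ⫽-cong (∥-∙-ε (firstRow w) 𝟎) (∥-∙-ε (restRows w) 𝟏) ⟩
      (firstRow w ⫽ restRows w)                              ≈⟨ ⫽-η w ⟩
      w                                                      ∎)

  -- A nonzero first entry allows `w` itself as first column of `g`. Otherwise some later entry is
  -- nonzero, and a vector with first entry 1 is reached first and then sheared onto `w`.
  ≢𝟎⇒transport : (w : M (suc n) 1) → ¬ w ≐ 𝟎 → ∃ λ g → Invertible g × g ∙ ε ≐ w
  ≢𝟎⇒transport {n} w w≢𝟎 with firstRow w ≐? 𝟎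
  ... | no w₀≢𝟎 = first≢𝟎⇒transport w w₀≢𝟎
  ... | yes w₀≐𝟎
    with ≢𝟎⇒entry≢0 (restRows w) (λ e → w≢𝟎 (≐-trans (≐-sym (⫽-η w)) (≐-trans (⫽-cong w₀≐𝟎 e) 𝟎-⫽)))
  ... | k , x≢0 with inverse (restRows w k zero) x≢0
  ... | y , e with first≢𝟎⇒transport (𝟏 ⫽ restRows w) (λ e → 𝟏₁≢𝟎 (≐-trans (≐-sym (firstRow-⫽ 𝟏 (restRows w))) e))
  -- The row `ρ` is a unit row rescaled to satisfy `ρ ∙ w′ ≐ 𝟏`; shearing by its negative lowers the
  -- first entry of `𝟏 ⫽ w′` from 1 to 0.
  ... | g , G , gε = upper (⊝ ρ) ∙ g , ∙-invertible (upper-invertible (⊝ ρ)) G , (begin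
      upper (⊝ ρ) ∙ g ∙ ε                                ≈⟨ ∙-assoc _ g ε ⟩
      upper (⊝ ρ) ∙ (g ∙ ε)                              ≈⟨ ∙-congˡ _ gε ⟩
      upper (⊝ ρ) ∙ (𝟏 ⫽ w′)                             ≈⟨ ⫽-∙ (𝟏 ∥ ⊝ ρ) (𝟎 ∥ 𝟏) (𝟏 ⫽ w′) ⟩
      ((𝟏 ∥ ⊝ ρ) ∙ (𝟏 ⫽ w′) ⫽ (𝟎 ∥ 𝟏) ∙ (𝟏 ⫽ w′))        ≈⟨ ⫽-cong (∥-∙-⫽ 𝟏 (⊝ ρ) 𝟏 w′) (∥-∙-⫽ 𝟎 𝟏 𝟏 w′) ⟩
      (𝟏 ∙ 𝟏 ⊕ ⊝ ρ ∙ w′ ⫽ 𝟎 ∙ 𝟏 ⊕ 𝟏 ∙ w′)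
        ≈⟨ ⫽-cong (⊕-cong (∙-identityˡ 𝟏) (≐-trans (⊝-∙ ρ w′) (⊝-cong ρw′)))
                  (≐-trans (⊕-cong (∙-zeroˡ 𝟏) (∙-identityˡ w′)) (⊕-identityˡ w′)) ⟩
      (𝟏 ⊖ 𝟏 ⫽ w′)                                       ≈⟨ ⫽-cong (≐-trans (⊝-inverseʳ 𝟏) (≐-sym w₀≐𝟎)) ≐-refl ⟩
      (firstRow w ⫽ w′)                                  ≈⟨ ⫽-η w ⟩
      w                                                  ∎)
    where
    w′ = restRows w
    ρ : M 1 n
    ρ = scalar y ∙ (λ _ → 𝟏 k)
    ρw′ : ρ ∙ w′ ≐ 𝟏
    ρw′ = begin
      scalar y ∙ (λ _ → 𝟏 k) ∙ w′     ≈⟨ ∙-assoc (scalar y) _ w′ ⟩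
      scalar y ∙ ((λ _ → 𝟏 k) ∙ w′)   ≈⟨ ∙-congˡ (scalar y) (unit-row-∙ k w′) ⟩
      scalar y ∙ scalar (w′ k zero)   ≈⟨ scalar-inverse (trans (*-comm y _) e) ⟩
      𝟏                               ∎

-- Matrices that kill the first basis vector, and their powers.

module BlockMatrices {q : ℕ} (F : FieldOn q) where
  open Counting
  open MatrixAlgebra F
  open import Data.Nat using (_∸_; _≤_) renaming (_+_ to _+ᴺ_; _^_ to _^ᴺ_)
  import Data.Nat.Properties as ℕₚ
  open import Data.List.Properties using (length-tabulate)

  open ≐-Reasoning

  private variable
    a b c d n : ℕ

  -- Matrices are functions and are compared entrywise, which is why all counts take place in
  -- setoids.
  matᴱ : ℕ → ℕ → Enum
  matᴱ a b = record
    { Carrier = M a b ; _≈_ = _≐_ ; ≈-refl = ≐-refl ; ≈-sym = ≐-sym ; ≈-trans = ≐-trans ; _≈?_ = _≐?_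
    ; elems = funs.elems
    ; once = λ A → trans (count-⇔ (A ≐?_) (A funs.≈?_) (λ _ → at) (λ _ → entrywise) funs.elems) (funs.once A) }
    where module funs = Enum (funᴱ a (funᴱ b (finᴱ q)))

  card-matᴱ : ∀ a b → card (matᴱ a b) ≡ (q ^ᴺ b) ^ᴺ a
  card-matᴱ a b = trans (length-allFuns (funᴱ b (finᴱ q)) a)
    (cong (_^ᴺ a) (trans (length-allFuns (finᴱ q) b) (cong (_^ᴺ b) (length-tabulate id))))

  card-column : ∀ n → card (matᴱ n 1) ≡ q ^ᴺ n
  card-column n = trans (card-matᴱ n 1) (cong (_^ᴺ n) (ℕₚ.*-identityʳ q))

  card-row : ∀ n → card (matᴱ 1 n) ≡ q ^ᴺ n
  card-row n = trans (card-matᴱ 1 n) (ℕₚ.*-identityʳ _)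

  ⊤? : {A : Set} (x : A) → Dec ⊤
  ⊤? _ = yes tt

  ∙-middle : {g : M a b} {h : M b a} → g ∙ h ≐ 𝟏 → (A : M c a) (B : M a d) → A ∙ g ∙ (h ∙ B) ≐ A ∙ B
  ∙-middle {g = g} {h} gh A B = begin
    A ∙ g ∙ (h ∙ B)     ≈⟨ ∙-assoc A g (h ∙ B) ⟩
    A ∙ (g ∙ (h ∙ B))   ≈⟨ ∙-congˡ A (∙-assoc g h B) ⟨
    A ∙ (g ∙ h ∙ B)     ≈⟨ ∙-congˡ A (∙-congʳ B gh) ⟩
    A ∙ (𝟏 ∙ B)         ≈⟨ ∙-congˡ A (∙-identityˡ B) ⟩
    A ∙ B               ∎

  module Conjugation {g h : M n n} (gh : g ∙ h ≐ 𝟏) (hg : h ∙ g ≐ 𝟏) where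

    conj-^ : ∀ N k → (h ∙ N ∙ g) ^ k ≐ h ∙ N ^ k ∙ g
    conj-^ N zero    = ≐-sym (≐-trans (∙-congʳ g (∙-identityʳ h)) hg)
    conj-^ N (suc k) = begin
      h ∙ N ∙ g ∙ (h ∙ N ∙ g) ^ k      ≈⟨ ∙-congˡ (h ∙ N ∙ g) (conj-^ N k) ⟩
      h ∙ N ∙ g ∙ (h ∙ N ^ k ∙ g)      ≈⟨ ∙-congˡ (h ∙ N ∙ g) (∙-assoc h (N ^ k) g) ⟩
      h ∙ N ∙ g ∙ (h ∙ (N ^ k ∙ g))    ≈⟨ ∙-middle gh (h ∙ N) (N ^ k ∙ g) ⟩
      h ∙ N ∙ (N ^ k ∙ g)              ≈⟨ ∙-assoc (h ∙ N) (N ^ k) g ⟨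
      h ∙ N ∙ N ^ k ∙ g                ≈⟨ ∙-congʳ g (∙-assoc h N (N ^ k)) ⟩
      h ∙ N ^ suc k ∙ g                ∎

    conj-^-col : ∀ N k (v : M n a) → (h ∙ N ∙ g) ^ k ∙ (h ∙ v) ≐ h ∙ (N ^ k ∙ v)
    conj-^-col N k v = begin
      (h ∙ N ∙ g) ^ k ∙ (h ∙ v)   ≈⟨ ∙-congʳ (h ∙ v) (conj-^ N k) ⟩
      h ∙ N ^ k ∙ g ∙ (h ∙ v)     ≈⟨ ∙-middle gh (h ∙ N ^ k) v ⟩
      h ∙ N ^ k ∙ v               ≈⟨ ∙-assoc h (N ^ k) v ⟩
      h ∙ (N ^ k ∙ v)             ∎

    conj-^-row : ∀ N k (r : M a n) → r ∙ g ∙ (h ∙ N ∙ g) ^ k ≐ r ∙ N ^ k ∙ g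
    conj-^-row N k r = begin
      r ∙ g ∙ (h ∙ N ∙ g) ^ k     ≈⟨ ∙-congˡ (r ∙ g) (≐-trans (conj-^ N k) (∙-assoc h (N ^ k) g)) ⟩
      r ∙ g ∙ (h ∙ (N ^ k ∙ g))   ≈⟨ ∙-middle gh r (N ^ k ∙ g) ⟩
      r ∙ (N ^ k ∙ g)             ≈⟨ ∙-assoc r (N ^ k) g ⟨
      r ∙ N ^ k ∙ g               ∎

  𝟎-∙ : {A : M a b} (B : M b c) → A ≐ 𝟎 → A ∙ B ≐ 𝟎
  𝟎-∙ B e = ≐-trans (∙-congʳ B e) (∙-zeroˡ B)

  ∙-𝟎 : (A : M a b) {B : M b c} → B ≐ 𝟎 → A ∙ B ≐ 𝟎
  ∙-𝟎 A e = ≐-trans (∙-congˡ A e) (∙-zeroʳ A)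

  ⫽-injective : {A C : M 1 b} {B D : M a b} → (A ⫽ B) ≐ (C ⫽ D) → A ≐ C × B ≐ D
  ⫽-injective e = ≐-trans (≐-sym (firstRow-⫽ _ _)) (≐-trans (firstRow-cong e) (firstRow-⫽ _ _))
                , ≐-trans (≐-sym (restRows-⫽ _ _)) (≐-trans (restRows-cong e) (restRows-⫽ _ _))

  ∥-injectiveʳ : {A C : M a 1} {B D : M a b} → A ∥ B ≐ C ∥ D → B ≐ D
  ∥-injectiveʳ e = ≐-trans (≐-sym (restCols-∥ _ _)) (≐-trans (restCols-cong e) (restCols-∥ _ _))

  -- The general form of a matrix that kills `ε` (see `cone-η`): `N` is the induced map on the
  -- quotient by `ε`, and `r` describes the extension.
  cone : M 1 n → M n n → M (suc n) (suc n)
  cone r N = 𝟎 ∥ r ⫽ 𝟎 ∥ N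

  cone-cong : {r s : M 1 n} {N L : M n n} → r ≐ s → N ≐ L → cone r N ≐ cone s L
  cone-cong e f = ⫽-cong (∥-cong ≐-refl e) (∥-cong ≐-refl f)

  cone-col : (r : M 1 n) (N : M n n) (x : M 1 1) (v : M n 1) → cone r N ∙ (x ⫽ v) ≐ (r ∙ v ⫽ N ∙ v)
  cone-col {n} r N x v = ≐-trans (⫽-∙ (𝟎 ∥ r) (𝟎 ∥ N) (x ⫽ v)) (⫽-cong (drop r) (drop N))
    where
    drop : (B : M a n) → (𝟎 ∥ B) ∙ (x ⫽ v) ≐ B ∙ v
    drop B = ≐-trans (∥-∙-⫽ 𝟎 B x v) (≐-trans (⊕-cong (∙-zeroˡ x) ≐-refl) (⊕-identityˡ (B ∙ v)))

  cone-∙ : (r s : M 1 n) (N L : M n n) → cone r N ∙ cone s L ≐ cone (r ∙ L) (N ∙ L)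
  cone-∙ {n} r s N L = ≐-trans (block-∙ 𝟎 r 𝟎 N 𝟎 s 𝟎 L) (⫽-cong (∥-cong (left r) (right r)) (∥-cong (left N) (right N)))
    where
    left : (B : M a n) → 𝟎 ∙ 𝟎 ⊕ B ∙ 𝟎 ≐ 𝟎
    left B = ≐-trans (⊕-cong (∙-zeroˡ 𝟎) (∙-zeroʳ B)) (⊕-identityˡ 𝟎)
    right : (B : M a n) → 𝟎 ∙ s ⊕ B ∙ L ≐ B ∙ L
    right B = ≐-trans (⊕-cong (∙-zeroˡ s) ≐-refl) (⊕-identityˡ (B ∙ L))

  cone-^ : (r : M 1 n) (N : M n n) (k : ℕ) → cone r N ^ suc k ≐ cone (r ∙ N ^ k) (N ^ suc k)
  cone-^ r N zero    = ≐-trans (∙-identityʳ _) (cone-cong (≐-sym (∙-identityʳ r)) (≐-sym (∙-identityʳ N)))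
  cone-^ r N (suc k) = ≐-trans (∙-congˡ (cone r N) (cone-^ r N k)) (cone-∙ r (r ∙ N ^ k) N (N ^ suc k))

  -- This is the source of the drop of the exponent by one: a single factor moves the row `𝟏 ∥ b`
  -- into the quotient by `ε`, where the other `k` factors act as `N`.
  row-cone : (b r : M 1 n) (N : M n n) (k : ℕ) → (𝟏 ∥ b) ∙ cone r N ^ suc k ≐ 𝟎 ∥ (r ⊕ b ∙ N) ∙ N ^ k
  row-cone b r N k = begin
    (𝟏 ∥ b) ∙ cone r N ^ suc k                                  ≈⟨ ∙-congˡ (𝟏 ∥ b) (cone-^ r N k) ⟩
    (𝟏 ∥ b) ∙ (𝟎 ∥ r ∙ N ^ k ⫽ 𝟎 ∥ N ^ suc k)                   ≈⟨ ∥-∙-⫽ 𝟏 b (𝟎 ∥ r ∙ N ^ k) (𝟎 ∥ N ^ suc k) ⟩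
    𝟏 ∙ (𝟎 ∥ r ∙ N ^ k) ⊕ b ∙ (𝟎 ∥ N ^ suc k)                   ≈⟨ ⊕-cong (∙-identityˡ _) (∙-∥ b 𝟎 (N ^ suc k)) ⟩
    (𝟎 ∥ r ∙ N ^ k) ⊕ (b ∙ 𝟎 ∥ b ∙ N ^ suc k)                   ≈⟨ ∥-⊕ 𝟎 (b ∙ 𝟎) (r ∙ N ^ k) (b ∙ N ^ suc k) ⟩
    𝟎 ⊕ b ∙ 𝟎 ∥ r ∙ N ^ k ⊕ b ∙ N ^ suc k
      ≈⟨ ∥-cong (≐-trans (⊕-identityˡ (b ∙ 𝟎)) (∙-zeroʳ b)) (⊕-cong ≐-refl (≐-sym (∙-assoc b N (N ^ k)))) ⟩
    𝟎 ∥ r ∙ N ^ k ⊕ b ∙ N ∙ N ^ k                               ≈⟨ ∥-cong ≐-refl (∙-distribʳ (N ^ k) r (b ∙ N)) ⟨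
    𝟎 ∥ (r ⊕ b ∙ N) ∙ N ^ k                                     ∎

  cone≐𝟎 : {r : M 1 n} {N : M n n} → r ≐ 𝟎 → N ≐ 𝟎 → cone r N ≐ 𝟎
  cone≐𝟎 e f = ≐-trans (cone-cong e f) (≐-trans (⫽-cong 𝟎-∥ 𝟎-∥) 𝟎-⫽)

  cone≐𝟎⁻¹ : {r : M 1 n} {N : M n n} → cone r N ≐ 𝟎 → r ≐ 𝟎 × N ≐ 𝟎
  cone≐𝟎⁻¹ {r = r} {N} e with ⫽-injective (≐-trans e (≐-sym (≐-trans (⫽-cong 𝟎-∥ 𝟎-∥) 𝟎-⫽)))
  ... | f , g = ∥-injectiveʳ f , ∥-injectiveʳ g

  top : M (suc n) (suc n) → M 1 n
  top N = restCols (firstRow N)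

  core : M (suc n) (suc n) → M n n
  core N = restCols (restRows N)

  cone-η : (N : M (suc n) (suc n)) → N ∙ ε ≐ 𝟎 → cone (top N) (core N) ≐ N
  cone-η N Nε = begin
    (𝟎 ∥ top N ⫽ 𝟎 ∥ core N)
      ≈⟨ ⫽-cong (∥-cong (≐-sym (proj₁ zeros)) ≐-refl) (∥-cong (≐-sym (proj₂ zeros)) ≐-refl) ⟩
    (firstCol (firstRow N) ∥ top N ⫽ firstCol (restRows N) ∥ core N)   ≈⟨ ⫽-cong (∥-η (firstRow N)) (∥-η (restRows N)) ⟩
    (firstRow N ⫽ restRows N)                                          ≈⟨ ⫽-η N ⟩
    N                                                                  ∎
    where
    zeros : firstCol (firstRow N) ≐ 𝟎 × firstCol (restRows N) ≐ 𝟎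
    zeros = ⫽-injective (begin
      (firstCol (firstRow N) ⫽ firstCol (restRows N))   ≈⟨ ⫽-cong (∙-ε (firstRow N)) (∙-ε (restRows N)) ⟨
      (firstRow N ∙ ε ⫽ restRows N ∙ ε)                 ≈⟨ ⫽-∙ (firstRow N) (restRows N) ε ⟨
      (firstRow N ⫽ restRows N) ∙ ε                     ≈⟨ ∙-congʳ ε (⫽-η N) ⟩
      N ∙ ε                                             ≈⟨ Nε ⟩
      𝟎                                                 ≈⟨ 𝟎-⫽ ⟨
      (𝟎 ⫽ 𝟎)                                           ∎)

  row-η : (r : M 1 (suc n)) → r ∙ ε ≐ 𝟏 → 𝟏 ∥ restCols r ≐ r
  row-η r rε = ≐-trans (∥-cong (≐-trans (≐-sym rε) (∙-ε r)) ≐-refl) (∥-η r)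

  ^-zero-mono : ∀ {j k} (s : M a n) (N : M n n) → j ≤ k → s ∙ N ^ j ≐ 𝟎 → s ∙ N ^ k ≐ 𝟎
  ^-zero-mono {j = j} {k} s N j≤k e = begin
    s ∙ N ^ k                     ≈⟨ ∙-congˡ s (^-cong ≐-refl (sym (ℕₚ.m+[n∸m]≡n j≤k))) ⟩
    s ∙ N ^ (j +ᴺ (k ∸ j))        ≈⟨ ∙-congˡ s (^-homo-* N j (k ∸ j)) ⟩
    s ∙ (N ^ j ∙ N ^ (k ∸ j))     ≈⟨ ∙-assoc s (N ^ j) (N ^ (k ∸ j)) ⟨
    s ∙ N ^ j ∙ N ^ (k ∸ j)       ≈⟨ 𝟎-∙ (N ^ (k ∸ j)) e ⟩
    𝟎                             ∎

-- The counted families of nilpotent matrices with vectors and rows, and their direct relations.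

module NilpotentCounts {q : ℕ} (F : FieldOn q) (m-1 : ℕ) where
  open Counting
  open MatrixAlgebra F
  open BlockMatrices F
  open import Data.Nat using () renaming (_+_ to _+ᴺ_; _*_ to _*ᴺ_; _^_ to _^ᴺ_)
  import Data.Nat.Properties as ℕₚ

  open ≐-Reasoning

  private
    m = suc m-1
    variable
      n : ℕ

  opaque
    nilpotents : ℕ → ℕ
    nilpotents n = # (matᴱ n n) (λ N → N ^ m ≐? 𝟎)

  Killed : (j n : ℕ) → M n n × M n 1 → Set
  Killed j n (N , v) = N ^ m ≐ 𝟎 × N ^ j ∙ v ≐ 𝟎

  killed? : ∀ j n → Decidable (Killed j n)
  killed? j n (N , v) = (N ^ m ≐? 𝟎) ×-dec (N ^ j ∙ v ≐? 𝟎)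

  opaque
    -- This is G_j(n) of the overview, `nilpotents n` is a(n), and `order i n` is the difference
    -- G_{i+1}(n) - G_i(n).
    killed : (j n : ℕ) → ℕ
    killed j n = # (matᴱ n n ⊗ᴱ matᴱ n 1) (killed? j n)

  Killedᵀ : (j n : ℕ) → M n n × M 1 n → Set
  Killedᵀ j n (N , r) = N ^ m ≐ 𝟎 × r ∙ N ^ j ≐ 𝟎

  killedᵀ? : ∀ j n → Decidable (Killedᵀ j n)
  killedᵀ? j n (N , r) = (N ^ m ≐? 𝟎) ×-dec (r ∙ N ^ j ≐? 𝟎)

  opaque
    killedᵀ : (j n : ℕ) → ℕ
    killedᵀ j n = # (matᴱ n n ⊗ᴱ matᴱ 1 n) (killedᵀ? j n)

  Order : (i n : ℕ) → M n n × M n 1 → Set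
  Order i n (N , v) = N ^ m ≐ 𝟎 × N ^ suc i ∙ v ≐ 𝟎 × ¬ N ^ i ∙ v ≐ 𝟎

  order? : ∀ i n → Decidable (Order i n)
  order? i n (N , v) = (N ^ m ≐? 𝟎) ×-dec ((N ^ suc i ∙ v ≐? 𝟎) ×-dec ¬? (N ^ i ∙ v ≐? 𝟎))

  opaque
    -- Pairs (N , v) in which v generates a cyclic submodule of dimension suc i.
    order : (i n : ℕ) → ℕ
    order i n = # (matᴱ n n ⊗ᴱ matᴱ n 1) (order? i n)

  -- The pairing with `N ^ i ∙ v` normalises `r` on the end of the chain of `v`. The index `j` is
  -- the parameter of the recursion, which lowers `i`, `j` and `n` together.
  Dual : (i j n : ℕ) → (M n n × M n 1) × M 1 n → Set
  Dual i j n ((N , v) , r) = N ^ m ≐ 𝟎 × N ^ suc i ∙ v ≐ 𝟎 × r ∙ (N ^ i ∙ v) ≐ 𝟏 × r ∙ N ^ j ≐ 𝟎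

  dual? : ∀ i j n → Decidable (Dual i j n)
  dual? i j n ((N , v) , r) =
    (N ^ m ≐? 𝟎) ×-dec ((N ^ suc i ∙ v ≐? 𝟎) ×-dec ((r ∙ (N ^ i ∙ v) ≐? 𝟏) ×-dec (r ∙ N ^ j ≐? 𝟎)))

  tripleᴱ : ℕ → Enum
  tripleᴱ n = (matᴱ n n ⊗ᴱ matᴱ n 1) ⊗ᴱ matᴱ 1 n

  opaque
    dual : (i j n : ℕ) → ℕ
    dual i j n = # (tripleᴱ n) (dual? i j n)

  ^-∙-cong : ∀ {a} {N L : M n n} {v w : M n a} (k : ℕ) → N ≐ L → v ≐ w → N ^ k ∙ v ≐ L ^ k ∙ w
  ^-∙-cong k e f = ∙-cong (^-congˡ k e) f

  ∙-^-cong : ∀ {a} {N L : M n n} {r s : M a n} (k : ℕ) → N ≐ L → r ≐ s → r ∙ N ^ k ≐ s ∙ L ^ k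
  ∙-^-cong k e f = ∙-cong f (^-congˡ k e)

  Killedᵀ-resp : ∀ j → let open Enum (matᴱ n n ⊗ᴱ matᴱ 1 n) in ∀ {x y} → x ≈ y → Killedᵀ j n x → Killedᵀ j n y
  Killedᵀ-resp j (e , f) (p , p′) = ≐-trans (≐-sym (^-congˡ m e)) p , ≐-trans (≐-sym (∙-^-cong j e f)) p′

  Killed-resp : ∀ j → let open Enum (matᴱ n n ⊗ᴱ matᴱ n 1) in ∀ {x y} → x ≈ y → Killed j n x → Killed j n y
  Killed-resp j (e , f) (p , p′) = ≐-trans (≐-sym (^-congˡ m e)) p , ≐-trans (≐-sym (^-∙-cong j e f)) p′

  Dual-resp : ∀ i j → let open Enum (tripleᴱ n) in ∀ {x y} → x ≈ y → Dual i j n x → Dual i j n y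
  Dual-resp i j ((e , f) , g) (p₁ , p₂ , p₃ , p₄) =
      ≐-trans (≐-sym (^-congˡ m e)) p₁
    , ≐-trans (≐-sym (^-∙-cong (suc i) e f)) p₂
    , ≐-trans (≐-sym (∙-cong g (^-∙-cong i e f))) p₃
    , ≐-trans (≐-sym (∙-^-cong j e g)) p₄

  ^-suc-∙ : ∀ {a} (N : M n n) (k : ℕ) (v : M n a) → N ^ suc k ∙ v ≐ N ∙ (N ^ k ∙ v)
  ^-suc-∙ N k v = ∙-assoc N (N ^ k) v

  opaque
    unfolding nilpotents killed killedᵀ order dual

    killed-zero : ∀ n → killed 0 n ≡ nilpotents n
    killed-zero n = trans
      (#-dependent (matᴱ n n) (matᴱ n 1) (λ N v → killed? 0 n (N , v)) (λ N → N ^ m ≐? 𝟎) 1 proj₁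
        (λ N p → trans (count-⇔ _ (𝟎 ≐?_)
          (λ v (_ , e) → ≐-sym (≐-trans (≐-sym (∙-identityˡ v)) e))
          (λ v e → p , ≐-trans (∙-identityˡ v) (≐-sym e)) (Enum.elems (matᴱ n 1)))
          (Enum.once (matᴱ n 1) 𝟎)))
      (ℕₚ.*-identityʳ _)

  opaque
    unfolding nilpotents killed killedᵀ order dual

    killed-full : ∀ n → killed m n ≡ nilpotents n *ᴺ q ^ᴺ n
    killed-full n = #-dependent (matᴱ n n) (matᴱ n 1) (λ N v → killed? m n (N , v)) (λ N → N ^ m ≐? 𝟎) (q ^ᴺ n) proj₁
      (λ N p → trans (count-⇔ _ ⊤? (λ _ _ → tt) (λ v _ → p , 𝟎-∙ v p) (Enum.elems (matᴱ n 1)))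
        (trans (count-all ⊤? _ (Enum.elems (matᴱ n 1))) (card-column n)))

  opaque
    unfolding nilpotents killed killedᵀ order dual

    killed-suc : ∀ i n → killed (suc i) n ≡ killed i n +ᴺ order i n
    killed-suc i n = trans (count-split (killed? (suc i) n) (λ (N , v) → N ^ i ∙ v ≐? 𝟎) elems)
      (cong₂ _+ᴺ_
        (count-⇔ _ (killed? i n) (λ _ ((p , _) , e) → p , e)
          (λ (N , v) (p , e) → (p , ≐-trans (^-suc-∙ N i v) (∙-𝟎 N e)) , e) elems)
        (count-⇔ _ (order? i n) (λ _ ((p , e) , ne) → p , e , ne) (λ _ (p , e , ne) → (p , e) , ne) elems))
      where open Enum (matᴱ n n ⊗ᴱ matᴱ n 1)

  ᵀ-^ : (N : M n n) (k : ℕ) → (N ^ k) ᵀ ≐ N ᵀ ^ k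
  ᵀ-^ N zero    = 𝟏-ᵀ
  ᵀ-^ N (suc k) = begin
    (N ∙ N ^ k) ᵀ      ≈⟨ ∙-ᵀ N (N ^ k) ⟩
    (N ^ k) ᵀ ∙ N ᵀ    ≈⟨ ∙-congʳ (N ᵀ) (ᵀ-^ N k) ⟩
    N ᵀ ^ k ∙ N ᵀ      ≈⟨ ^-sucʳ (N ᵀ) k ⟨
    N ᵀ ^ suc k        ∎

  opaque
    unfolding nilpotents killed killedᵀ order dual

    -- The splitting ends with a row condition; transposition returns it to the column counts, which
    -- closes the recursion.
    killed-transpose : ∀ j n → killed j n ≡ killedᵀ j n
    killed-transpose j n = #-bij (matᴱ n n ⊗ᴱ matᴱ n 1) (matᴱ n n ⊗ᴱ matᴱ 1 n) (killed? j n) (killedᵀ? j n)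
      (λ (N , v) → N ᵀ , v ᵀ) (λ (N , r) → N ᵀ , r ᵀ) (Killed-resp j) (Killedᵀ-resp j)
      (λ (e , f) → ᵀ-cong e , ᵀ-cong f) (λ (e , f) → ᵀ-cong e , ᵀ-cong f)
      (λ {(N , v)} (p , p′) → nil N p , (begin
        v ᵀ ∙ N ᵀ ^ j      ≈⟨ ∙-congˡ (v ᵀ) (ᵀ-^ N j) ⟨
        v ᵀ ∙ (N ^ j) ᵀ    ≈⟨ ∙-ᵀ (N ^ j) v ⟨
        (N ^ j ∙ v) ᵀ      ≈⟨ ᵀ-cong p′ ⟩
        𝟎 ᵀ                ≈⟨ 𝟎-ᵀ ⟩
        𝟎                  ∎))
      (λ {(N , r)} (p , p′) → nil N p , (begin
        N ᵀ ^ j ∙ r ᵀ      ≈⟨ ∙-congʳ (r ᵀ) (ᵀ-^ N j) ⟨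
        (N ^ j) ᵀ ∙ r ᵀ    ≈⟨ ∙-ᵀ r (N ^ j) ⟨
        (r ∙ N ^ j) ᵀ      ≈⟨ ᵀ-cong p′ ⟩
        𝟎 ᵀ                ≈⟨ 𝟎-ᵀ ⟩
        𝟎                  ∎))
      (λ {(N , v)} _ → ᵀ-involutive N , ᵀ-involutive v) (λ {(N , r)} _ → ᵀ-involutive N , ᵀ-involutive r)
      where
      nil : (N : M n n) → N ^ m ≐ 𝟎 → N ᵀ ^ m ≐ 𝟎
      nil N p = ≐-trans (≐-sym (ᵀ-^ N m)) (≐-trans (ᵀ-cong p) 𝟎-ᵀ)

  -- In a basis starting with `w` the condition fixes the first entry of `r` to 1 and leaves the
  -- other `n` entries free.
  hyperplane : (w : M (suc n) 1) → ¬ w ≐ 𝟎 → # (matᴱ 1 (suc n)) (λ r → r ∙ w ≐? 𝟏) ≡ q ^ᴺ n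
  hyperplane {n} w w≢𝟎 with ≢𝟎⇒transport w w≢𝟎
  ... | g , G , gε = trans
    (#-bij (matᴱ 1 (suc n)) (matᴱ 1 n) (λ r → r ∙ w ≐? 𝟏) ⊤?
      (λ r → restCols (r ∙ g)) (λ b → (𝟏 ∥ b) ∙ inv)
      (λ e p → ≐-trans (∙-congʳ w (≐-sym e)) p) (λ _ _ → tt)
      (λ e → restCols-cong (∙-congʳ g e)) (λ e → ∙-congʳ inv (∥-cong ≐-refl e))
      (λ _ → tt)
      (λ {b} _ → begin
        (𝟏 ∥ b) ∙ inv ∙ w          ≈⟨ ∙-congˡ _ gε ⟨
        (𝟏 ∥ b) ∙ inv ∙ (g ∙ ε)    ≈⟨ ∙-middle invˡ (𝟏 ∥ b) ε ⟩
        (𝟏 ∥ b) ∙ ε                ≈⟨ ∥-∙-ε 𝟏 b ⟩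
        𝟏                          ∎)
      (λ {r} rw → begin
        (𝟏 ∥ restCols (r ∙ g)) ∙ inv   ≈⟨ ∙-congʳ inv (row-η (r ∙ g) (≐-trans (∙-assoc r g ε) (≐-trans (∙-congˡ r gε) rw))) ⟩
        r ∙ g ∙ inv                    ≈⟨ ∙-assoc r g inv ⟩
        r ∙ (g ∙ inv)                  ≈⟨ ∙-congˡ r invʳ ⟩
        r ∙ 𝟏                          ≈⟨ ∙-identityʳ r ⟩
        r                              ∎)
      (λ {b} _ → begin
        restCols ((𝟏 ∥ b) ∙ inv ∙ g)     ≈⟨ restCols-cong (≐-trans (∙-assoc (𝟏 ∥ b) inv g) (∙-congˡ (𝟏 ∥ b) invˡ)) ⟩
        restCols ((𝟏 ∥ b) ∙ 𝟏)           ≈⟨ restCols-cong (∙-identityʳ (𝟏 ∥ b)) ⟩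
        restCols (𝟏 ∥ b)                 ≈⟨ restCols-∥ 𝟏 b ⟩
        b                                ∎))
    (trans (count-all ⊤? _ (Enum.elems (matᴱ 1 n))) (card-row n))
    where open Invertible G

  opaque
    unfolding nilpotents killed killedᵀ order dual

    -- For `j = m` the condition on `r ∙ N ^ j` follows from `N ^ m ≐ 𝟎`, so only the pairing
    -- restricts `r`, and `hyperplane` counts the choices.
    order-dual : ∀ i n → order i (suc n) *ᴺ q ^ᴺ n ≡ dual i m (suc n)
    order-dual i n = sym
      (#-dependent (matᴱ (suc n) (suc n) ⊗ᴱ matᴱ (suc n) 1) (matᴱ 1 (suc n))
        (λ (N , v) r → dual? i m (suc n) ((N , v) , r)) (order? i (suc n)) (q ^ᴺ n)
        (λ {(N , v)} {r} (p , p′ , e , _) → p , p′ , λ z → 𝟏₁≢𝟎 (≐-trans (≐-sym e) (∙-𝟎 r z)))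
        (λ (N , v) (p , p′ , ne) → trans
          (count-⇔ _ (λ r → r ∙ (N ^ i ∙ v) ≐? 𝟏) (λ _ (_ , _ , e , _) → e) (λ r e → p , p′ , e , ∙-𝟎 r p)
            (Enum.elems (matᴱ 1 (suc n))))
          (hyperplane (N ^ i ∙ v) ne)))

-- Splitting off one dimension.

module DimensionRecursion {q : ℕ} (F : FieldOn q) (m-1 : ℕ) where
  open Counting
  open MatrixAlgebra F
  open BlockMatrices F
  open NilpotentCounts F m-1
  open import Data.Nat using (_∸_; _≤_) renaming (_+_ to _+ᴺ_; _*_ to _*ᴺ_; _^_ to _^ᴺ_)
  import Data.Nat.Properties as ℕₚ

  open ≐-Reasoning

  private
    m = suc m-1
    variable
      n : ℕ

  count-nonzero : ∀ n → # (matᴱ n 1) (λ w → ¬? (w ≐? 𝟎)) ≡ q ^ᴺ n ∸ 1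
  count-nonzero n = sym (cong (_∸ 1) (trans (sym (card-column n)) (trans (sym (count-all ⊤? _ elems))
    (trans (count-split ⊤? (_≐? 𝟎) elems) (cong₂ _+ᴺ_
      (trans (count-⇔ _ (𝟎 ≐?_) (λ w (_ , e) → ≐-sym e) (λ w e → tt , ≐-sym e) elems) (once 𝟎))
      (count-⇔ _ (λ w → ¬? (w ≐? 𝟎)) (λ w → proj₂) (λ w e → tt , e) elems))))))
    where open Enum (matᴱ n 1)

  DualAt : (i j : ℕ) {n : ℕ} → M n 1 → (M n n × M n 1) × M 1 n → Set
  DualAt i j {n} w x@((N , v) , _) = Dual i j n x × N ^ i ∙ v ≐ w

  dualAt? : ∀ i j {n} (w : M n 1) → Decidable (DualAt i j w)
  dualAt? i j {n} w x@((N , v) , _) = dual? i j n x ×-dec (N ^ i ∙ v ≐? w)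

  DualAt-resp : ∀ i j (w : M n 1) → let open Enum (tripleᴱ n) in ∀ {x y} → x ≈ y → DualAt i j w x → DualAt i j w y
  DualAt-resp i j w E@((e , f) , _) (d , p) = Dual-resp i j E d , ≐-trans (≐-sym (^-∙-cong i e f)) p

  conj : (g h : M n n) → (M n n × M n 1) × M 1 n → (M n n × M n 1) × M 1 n
  conj g h ((N , v) , r) = (h ∙ N ∙ g , h ∙ v) , r ∙ g

  conj-DualAt : {g h : M n n} → g ∙ h ≐ 𝟏 → h ∙ g ≐ 𝟏 → ∀ i j {w w′ : M n 1} → h ∙ w ≐ w′ → ∀ {x} →
                DualAt i j w x → DualAt i j w′ (conj g h x)
  conj-DualAt {g = g} {h} gh hg i j {w} {w′} hw {((N , v) , r)} ((p₁ , p₂ , p₃ , p₄) , p₅) =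
    ( (begin
        (h ∙ N ∙ g) ^ m     ≈⟨ conj-^ N m ⟩
        h ∙ N ^ m ∙ g       ≈⟨ 𝟎-∙ g (∙-𝟎 h p₁) ⟩
        𝟎                   ∎)
    , ≐-trans (conj-^-col N (suc i) v) (∙-𝟎 h p₂)
    , (begin
        r ∙ g ∙ ((h ∙ N ∙ g) ^ i ∙ (h ∙ v))   ≈⟨ ∙-congˡ (r ∙ g) (conj-^-col N i v) ⟩
        r ∙ g ∙ (h ∙ (N ^ i ∙ v))             ≈⟨ ∙-middle gh r (N ^ i ∙ v) ⟩
        r ∙ (N ^ i ∙ v)                       ≈⟨ p₃ ⟩
        𝟏                                     ∎)
    , ≐-trans (conj-^-row N j r) (𝟎-∙ g p₄))
    , ≐-trans (conj-^-col N i v) (≐-trans (∙-congˡ h p₅) hw)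
    where open Conjugation gh hg

  conj-cong : (g h : M n n) → let open Enum (tripleᴱ n) in ∀ {x y} → x ≈ y → conj g h x ≈ conj g h y
  conj-cong g h ((e , f) , k) = (∙-congʳ g (∙-congˡ h e) , ∙-congˡ h f) , ∙-congʳ g k

  conj-inverse : {g h : M n n} → g ∙ h ≐ 𝟏 → let open Enum (tripleᴱ n) in ∀ {x} → conj h g (conj g h x) ≈ x
  conj-inverse {g = g} {h} gh {((N , v) , r)} =
    ( (begin
        g ∙ (h ∙ N ∙ g) ∙ h     ≈⟨ ∙-congʳ h (∙-congˡ g (∙-assoc h N g)) ⟩
        g ∙ (h ∙ (N ∙ g)) ∙ h   ≈⟨ ∙-congʳ h (cancelˡ (N ∙ g)) ⟩
        N ∙ g ∙ h               ≈⟨ cancelʳ N ⟩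
        N                       ∎)
    , cancelˡ v) , cancelʳ r
    where
    cancelˡ : ∀ {a} (A : M _ a) → g ∙ (h ∙ A) ≐ A
    cancelˡ A = ≐-trans (≐-sym (∙-assoc g h A)) (≐-trans (∙-congʳ A gh) (∙-identityˡ A))
    cancelʳ : ∀ {a} (A : M a _) → A ∙ g ∙ h ≐ A
    cancelʳ A = ≐-trans (∙-assoc A g h) (≐-trans (∙-congˡ A gh) (∙-identityʳ A))

  opaque
    unfolding killedᵀ dual

    -- The vector `N ^ i ∙ v` is nonzero because it pairs to 1 with `r`. Conjugation acts
    -- transitively on its possible values, so all fibres are as large as the one over `ε`.
    dual-fibres : ∀ i j n → dual i j (suc n) ≡ (q ^ᴺ suc n ∸ 1) *ᴺ # (tripleᴱ (suc n)) (dualAt? i j ε)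
    dual-fibres i j n = trans
      (#-fibres (tripleᴱ (suc n)) (matᴱ (suc n) 1) (dual? i j (suc n)) (λ w → ¬? (w ≐? 𝟎))
        (λ ((N , v) , _) → N ^ i ∙ v) (# (tripleᴱ (suc n)) (dualAt? i j ε))
        (λ e ne z → ne (≐-trans e z))
        (λ { {((N , v) , r)} (_ , _ , e , _) z → 𝟏₁≢𝟎 (≐-trans (≐-sym e) (∙-𝟎 r z)) })
        fibre)
      (cong (_*ᴺ # (tripleᴱ (suc n)) (dualAt? i j ε)) (count-nonzero (suc n)))
      where
      fibre : ∀ w → ¬ w ≐ 𝟎 → # (tripleᴱ (suc n)) (dualAt? i j w) ≡ # (tripleᴱ (suc n)) (dualAt? i j ε)
      fibre w w≢𝟎 with ≢𝟎⇒transport w w≢𝟎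
      ... | g , G , gε = #-bij (tripleᴱ (suc n)) (tripleᴱ (suc n)) (dualAt? i j w) (dualAt? i j ε)
        (conj g inv) (conj inv g) (DualAt-resp i j w) (DualAt-resp i j ε)
        (conj-cong g inv) (conj-cong inv g)
        (conj-DualAt invʳ invˡ i j (≐-trans (∙-congˡ inv (≐-sym gε))
          (≐-trans (≐-sym (∙-assoc inv g ε)) (≐-trans (∙-congʳ ε invˡ) (∙-identityˡ ε)))))
        (conj-DualAt invˡ invʳ i j gε)
        (λ _ → conj-inverse invʳ) (λ _ → conj-inverse invˡ)
        where open Invertible G

  -- For N = cone t N′ and r = (1 , b) one has r N ^ (j + 1) = (0 , (t + b N′) N′ ^ j): replacing t by t + b N′ turns
  -- the conditions on (N , r) into conditions of the same shape one dimension lower.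
  compress : M (suc n) (suc n) → M 1 (suc n) → M 1 n
  compress N r = top N ⊕ restCols r ∙ core N

  compress-cong : {N L : M (suc n) (suc n)} {r s : M 1 (suc n)} → N ≐ L → r ≐ s → compress N r ≐ compress L s
  compress-cong e f = ⊕-cong (restCols-cong (firstRow-cong e)) (∙-cong (restCols-cong f) (restCols-cong (restRows-cong e)))

  -- Solves `compress` for the top row; hence `s` and `b` can be prescribed independently.
  expand : M n n → M 1 n → M 1 n → M (suc n) (suc n)
  expand N s b = cone (s ⊖ b ∙ N) N

  expand-cong : {N L : M n n} {s t b c : M 1 n} → N ≐ L → s ≐ t → b ≐ c → expand N s b ≐ expand L t c
  expand-cong e f g = cone-cong (⊕-cong f (⊝-cong (∙-cong g e))) e

  top-cone : (t : M 1 n) (N : M n n) → top (cone t N) ≐ t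
  top-cone t N = ≐-trans (restCols-cong (firstRow-⫽ _ _)) (restCols-∥ 𝟎 t)

  core-cone : (t : M 1 n) (N : M n n) → core (cone t N) ≐ N
  core-cone t N = ≐-trans (restCols-cong (restRows-⫽ _ _)) (restCols-∥ 𝟎 N)

  compress-expand : (N : M n n) (s b : M 1 n) → compress (expand N s b) (𝟏 ∥ b) ≐ s
  compress-expand N s b = ≐-trans
    (⊕-cong (top-cone _ N) (∙-cong (restCols-∥ 𝟏 b) (core-cone (s ⊖ b ∙ N) N)))
    (⊖⊕-cancel s (b ∙ N))

  expand-compress : (N : M (suc n) (suc n)) (r : M 1 (suc n)) → N ∙ ε ≐ 𝟎 →
                    expand (core N) (compress N r) (restCols r) ≐ N
  expand-compress N r Nε = ≐-trans (cone-cong (⊕⊖-cancel (top N) _) ≐-refl) (cone-η N Nε)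

  ⊕-cancel-𝟎 : ∀ {a b} {A B : M a b} → A ⊕ B ≐ 𝟎 → B ≐ 𝟎 → A ≐ 𝟎
  ⊕-cancel-𝟎 {A = A} {B} e f = ≐-trans (≐-sym (≐-trans (⊕-cong ≐-refl f) (⊕-identityʳ A))) e

  module _ {n : ℕ} (t : M 1 n) (N : M n n) (b : M 1 n) (j : ℕ) where

    ^-cone≐𝟎 : (k : ℕ) → t ∙ N ^ k ≐ 𝟎 → N ^ suc k ≐ 𝟎 → cone t N ^ suc k ≐ 𝟎
    ^-cone≐𝟎 k e f = ≐-trans (cone-^ t N k) (cone≐𝟎 e f)

    ^-cone≐𝟎⁻¹ : (k : ℕ) → cone t N ^ suc k ≐ 𝟎 → t ∙ N ^ k ≐ 𝟎 × N ^ suc k ≐ 𝟎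
    ^-cone≐𝟎⁻¹ k e = cone≐𝟎⁻¹ (≐-trans (≐-sym (cone-^ t N k)) e)

    -- The m-th power of the cone vanishes when `N ^ m` and `t ∙ N ^ m-1` do. The latter is the
    -- difference of `(t ⊕ b ∙ N) ∙ N ^ m-1`, zero because `j ≤ m-1`, and `b ∙ N ^ m`.
    cone-killedᵀ : j ≤ m-1 → Killedᵀ j n (N , t ⊕ b ∙ N) → Killedᵀ (suc j) (suc n) (cone t N , 𝟏 ∥ b)
    cone-killedᵀ j≤ (p , e) =
        ^-cone≐𝟎 m-1 (⊕-cancel-𝟎
          (≐-trans (≐-sym (∙-distribʳ (N ^ m-1) t (b ∙ N))) (^-zero-mono (t ⊕ b ∙ N) N j≤ e))
          (≐-trans (∙-assoc b N (N ^ m-1)) (∙-𝟎 b p)))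
          p
      , ≐-trans (row-cone b t N j) (≐-trans (∥-cong ≐-refl e) 𝟎-∥)

    cone-killedᵀ⁻¹ : Killedᵀ (suc j) (suc n) (cone t N , 𝟏 ∥ b) → Killedᵀ j n (N , t ⊕ b ∙ N)
    cone-killedᵀ⁻¹ (p , e) =
        proj₂ (^-cone≐𝟎⁻¹ m-1 p)
      , ∥-injectiveʳ (≐-trans (≐-sym (row-cone b t N j)) (≐-trans e (≐-sym 𝟎-∥)))

    cone-^-col : (k : ℕ) (x : M 1 1) (v : M n 1) →
                 cone t N ^ suc k ∙ (x ⫽ v) ≐ (t ∙ (N ^ k ∙ v) ⫽ N ^ suc k ∙ v)
    cone-^-col k x v = begin
      cone t N ^ suc k ∙ (x ⫽ v)                    ≈⟨ ∙-congʳ (x ⫽ v) (cone-^ t N k) ⟩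
      cone (t ∙ N ^ k) (N ^ suc k) ∙ (x ⫽ v)        ≈⟨ cone-col (t ∙ N ^ k) (N ^ suc k) x v ⟩
      (t ∙ N ^ k ∙ v ⫽ N ^ suc k ∙ v)               ≈⟨ ⫽-cong (∙-assoc t (N ^ k) v) ≐-refl ⟩
      (t ∙ (N ^ k ∙ v) ⫽ N ^ suc k ∙ v)             ∎

    compressed-pairing : (w : M n 1) → N ∙ w ≐ 𝟎 → (t ⊕ b ∙ N) ∙ w ≐ t ∙ w
    compressed-pairing w e = ≐-trans (∙-distribʳ w t (b ∙ N))
      (≐-trans (⊕-cong ≐-refl (≐-trans (∙-assoc b N w) (∙-𝟎 b e))) (⊕-identityʳ (t ∙ w)))

    -- The first entry of `cone t N ^ suc i ∙ (x ⫽ v)` is `t ∙ (N ^ i ∙ v)`. So hitting `ε` in the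
    -- larger space amounts to the pairing condition and `N ^ suc i ∙ v ≐ 𝟎` in the smaller one.
    cone-dual : ∀ i (x : M 1 1) (v : M n 1) → j ≤ m-1 →
                Dual i j n ((N , v) , t ⊕ b ∙ N) → DualAt (suc i) (suc j) ε ((cone t N , x ⫽ v) , 𝟏 ∥ b)
    cone-dual i x v j≤ (p₁ , p₂ , p₃ , p₄) with cone-killedᵀ j≤ (p₁ , p₄)
    ... | nil , kills = (nil , last , paired , kills) , hits
      where
      hits : cone t N ^ suc i ∙ (x ⫽ v) ≐ ε
      hits = ≐-trans (cone-^-col i x v) (⫽-cong
        (≐-trans (≐-sym (compressed-pairing (N ^ i ∙ v) (≐-trans (≐-sym (^-suc-∙ N i v)) p₂))) p₃) p₂)
      last : cone t N ^ suc (suc i) ∙ (x ⫽ v) ≐ 𝟎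
      last = ≐-trans (cone-^-col (suc i) x v) (≐-trans
        (⫽-cong (∙-𝟎 t p₂) (≐-trans (^-suc-∙ N (suc i) v) (∙-𝟎 N p₂))) 𝟎-⫽)
      paired : (𝟏 ∥ b) ∙ (cone t N ^ suc i ∙ (x ⫽ v)) ≐ 𝟏
      paired = ≐-trans (∙-congˡ (𝟏 ∥ b) hits) (∥-∙-ε 𝟏 b)

    cone-dual⁻¹ : ∀ i (x : M 1 1) (v : M n 1) →
                  DualAt (suc i) (suc j) ε ((cone t N , x ⫽ v) , 𝟏 ∥ b) → Dual i j n ((N , v) , t ⊕ b ∙ N)
    cone-dual⁻¹ i x v ((p₁ , p₂ , p₃ , p₄) , hits)
      with cone-killedᵀ⁻¹ (p₁ , p₄) | ⫽-injective (≐-trans (≐-sym (cone-^-col i x v)) hits)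
    ... | nil , kills | e , f =
      nil , f , ≐-trans (compressed-pairing (N ^ i ∙ v) (≐-trans (≐-sym (^-suc-∙ N i v)) f)) e , kills

  DualAt⇒ε-killed : ∀ i j {N : M (suc n) (suc n)} {v r} → DualAt i j ε ((N , v) , r) → N ∙ ε ≐ 𝟎
  DualAt⇒ε-killed i j {N} {v} ((_ , p , _) , hits) = begin
    N ∙ ε              ≈⟨ ∙-congˡ N hits ⟨
    N ∙ (N ^ i ∙ v)    ≈⟨ ^-suc-∙ N i v ⟨
    N ^ suc i ∙ v      ≈⟨ p ⟩
    𝟎                  ∎

  DualAt⇒row : ∀ i j {N : M (suc n) (suc n)} {v r} → DualAt i j ε ((N , v) , r) → r ∙ ε ≐ 𝟏
  DualAt⇒row i j {r = r} ((_ , _ , p , _) , hits) = ≐-trans (∙-congˡ r (≐-sym hits)) p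

  opaque
    unfolding killedᵀ dual

    -- The data lost in the quotient are the first entry `x` of the vector and the tail `b` of the
    -- row. Both are unconstrained, giving the factors `q` and `q ^ n`.
    dualAt-suc : ∀ i j n → j ≤ m-1 →
                 # (tripleᴱ (suc n)) (dualAt? (suc i) (suc j) ε) ≡ q *ᴺ q ^ᴺ n *ᴺ dual i j n
    dualAt-suc i j n j≤ = trans
      (#-bij (tripleᴱ (suc n)) ((matᴱ 1 1 ⊗ᴱ matᴱ 1 n) ⊗ᴱ tripleᴱ n) (dualAt? (suc i) (suc j) ε)
        (λ (_ , y) → yes tt ×-dec dual? i j n y)
        (λ ((N , v) , r) → (firstRow v , restCols r) , ((core N , restRows v) , compress N r))
        (λ ((x , b) , ((N , v) , s)) → ((expand N s b , x ⫽ v) , 𝟏 ∥ b))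
        (DualAt-resp (suc i) (suc j) ε)
        (λ (_ , e) (_ , d) → tt , Dual-resp i j e d)
        (λ ((e , f) , g) → (firstRow-cong f , restCols-cong g) ,
           ((restCols-cong (restRows-cong e) , restRows-cong f) , compress-cong e g))
        (λ ((e , e′) , ((f , g) , h)) → (expand-cong f h e′ , ⫽-cong e g) , ∥-cong ≐-refl e′)
        (λ {((N , v) , r)} d → tt , cone-dual⁻¹ (top N) (core N) (restCols r) j i (firstRow v) (restRows v)
           (DualAt-resp (suc i) (suc j) ε
             ((≐-sym (cone-η N (DualAt⇒ε-killed (suc i) (suc j) d)) , ≐-sym (⫽-η v)) ,
              ≐-sym (row-η r (DualAt⇒row (suc i) (suc j) d))) d))
        (λ {((x , b) , ((N , v) , s))} (_ , d) → cone-dual (s ⊖ b ∙ N) N b j i x v j≤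
           (Dual-resp i j ((≐-refl , ≐-refl) , ≐-sym (⊖⊕-cancel s (b ∙ N))) d))
        (λ {((N , v) , r)} d →
           (expand-compress N r (DualAt⇒ε-killed (suc i) (suc j) d) , ⫽-η v) , row-η r (DualAt⇒row (suc i) (suc j) d))
        (λ {((x , b) , ((N , v) , s))} _ →
           (firstRow-⫽ x v , restCols-∥ 𝟏 b) , ((core-cone _ N , restRows-⫽ x v) , compress-expand N s b)))
      (trans (#-× (matᴱ 1 1 ⊗ᴱ matᴱ 1 n) (tripleᴱ n) ⊤? (dual? i j n)) (cong (_*ᴺ dual i j n) free))
      where
      free : # (matᴱ 1 1 ⊗ᴱ matᴱ 1 n) ⊤? ≡ q *ᴺ q ^ᴺ n
      free = trans (count-⇔ ⊤? (λ _ → yes tt ×-dec yes tt) (λ _ _ → tt , tt) (λ _ _ → tt) (Enum.elems (matᴱ 1 1 ⊗ᴱ matᴱ 1 n)))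
        (trans (#-× (matᴱ 1 1) (matᴱ 1 n) ⊤? ⊤?) (cong₂ _*ᴺ_
          (trans (count-all ⊤? _ (Enum.elems (matᴱ 1 1))) (trans (card-row 1) (ℕₚ.*-identityʳ q)))
          (trans (count-all ⊤? _ (Enum.elems (matᴱ 1 n))) (card-row n))))

  opaque
    unfolding killedᵀ dual

    -- The chain ends here: `v` is `ε` itself, so no vector and no pairing survive in the quotient,
    -- only the row `s` with `s ∙ N ^ j ≐ 𝟎`. The free tail `b` gives `q ^ n`.
    dualAt-zero : ∀ j n → j ≤ m-1 → # (tripleᴱ (suc n)) (dualAt? 0 (suc j) ε) ≡ q ^ᴺ n *ᴺ killedᵀ j n
    dualAt-zero j n j≤ = trans
      (#-bij (tripleᴱ (suc n)) (matᴱ 1 n ⊗ᴱ (matᴱ n n ⊗ᴱ matᴱ 1 n)) (dualAt? 0 (suc j) ε)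
        (λ (_ , y) → yes tt ×-dec killedᵀ? j n y)
        (λ ((N , v) , r) → restCols r , (core N , compress N r))
        (λ (b , (N , s)) → ((expand N s b , ε) , 𝟏 ∥ b))
        (DualAt-resp 0 (suc j) ε)
        (λ (_ , e) (_ , d) → tt , Killedᵀ-resp j e d)
        (λ ((e , f) , g) → restCols-cong g , (restCols-cong (restRows-cong e) , compress-cong e g))
        (λ (e , (f , h)) → (expand-cong f h e , ≐-refl) , ∥-cong ≐-refl e)
        (λ {((N , v) , r)} d@((p , _ , _ , k) , _) → tt , cone-killedᵀ⁻¹ (top N) (core N) (restCols r) j
           (Killedᵀ-resp (suc j)
             (≐-sym (cone-η N (DualAt⇒ε-killed 0 (suc j) d)) , ≐-sym (row-η r (DualAt⇒row 0 (suc j) d))) (p , k)))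
        (λ {(b , (N , s))} (_ , d) → from b N s
           (cone-killedᵀ (s ⊖ b ∙ N) N b j j≤ (Killedᵀ-resp j (≐-refl , ≐-sym (⊖⊕-cancel s (b ∙ N))) d)))
        (λ {((N , v) , r)} d@(_ , hits) →
           (expand-compress N r (DualAt⇒ε-killed 0 (suc j) d) , ≐-trans (≐-sym hits) (∙-identityˡ v))
           , row-η r (DualAt⇒row 0 (suc j) d))
        (λ {(b , (N , s))} _ → restCols-∥ 𝟏 b , (core-cone _ N , compress-expand N s b)))
      (trans (#-× (matᴱ 1 n) (matᴱ n n ⊗ᴱ matᴱ 1 n) ⊤? (killedᵀ? j n))
        (cong (_*ᴺ killedᵀ j n) (trans (count-all ⊤? _ (Enum.elems (matᴱ 1 n))) (card-row n))))
      where
      from : ∀ b N s → Killedᵀ (suc j) (suc n) (expand N s b , 𝟏 ∥ b) → DualAt 0 (suc j) ε ((expand N s b , ε) , 𝟏 ∥ b)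
      from b N s (p , k) =
        (p , ≐-trans (^-suc-∙ _ 0 ε) (≐-trans (∙-congˡ _ (∙-identityˡ ε))
               (≐-trans (cone-col _ N 𝟏 𝟎) (≐-trans (⫽-cong (∙-zeroʳ _) (∙-zeroʳ N)) 𝟎-⫽)))
           , ≐-trans (∙-congˡ (𝟏 ∥ b) (∙-identityˡ ε)) (∥-∙-ε 𝟏 b) , k)
        , ∙-identityˡ ε

-- From homomorphisms of a cyclic group to nilpotent matrices.

module Homomorphisms where
  open Counting
  open import Data.Nat as ℕ using (_∸_; z≤n; s≤s; _<_; _!) renaming (_+_ to _+ᴺ_; _*_ to _*ᴺ_; _^_ to _^ᴺ_)
  import Data.Nat.Properties as ℕₚ
  open import Data.Nat.DivMod using (m/n*n≡m)
  open import Data.Nat.Divisibility using (_∣_; divides; ∣⇒≤; m∣m*n)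
  open import Data.Nat.Primality using (Prime; euclidsLemma; prime⇒nonTrivial; prime⇒nonZero)
  open import Data.Nat.Combinatorics using (_C_; nCn≡1; nCk≡nC[n∸k]; nCk≡n!/k![n-k]!; k![n∸k]!∣n!)
  open import Data.Fin using (inject₁; fromℕ)
  open import Data.Fin.Properties using (toℕ-inject₁; toℕ-fromℕ; toℕ<n) renaming (_≟_ to _≟ᶠ_)
  open import Data.Fin.Induction using (<-weakInduction)
  open import Data.Fin.Permutation using (Permutation; permutation)
  open import Data.List using (List; _∷_)
  open import Data.List.Relation.Unary.Any as Any using (Any; here; there)
  open import Algebra.Bundles using (CommutativeRing; Ring)

  prime∤! : ∀ {p} → Prime p → ∀ k → k < p → ¬ p ∣ k !
  prime∤! {p} pr zero    k<p p∣ = ℕₚ.<⇒≱ (ℕ.nonTrivial⇒n>1 p {{prime⇒nonTrivial pr}}) (∣⇒≤ p∣)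
  prime∤! pr (suc k) k<p p∣ with euclidsLemma (suc k) (k !) pr p∣
  ... | inj₁ p∣k  = ℕₚ.<⇒≱ k<p (∣⇒≤ p∣k)
  ... | inj₂ p∣k! = prime∤! pr k (ℕₚ.<-trans (ℕₚ.n<1+n k) k<p) p∣k!

  -- The prime divides `p ! = (p C k) * (k ! * (p ∸ k) !)` but, by `prime∤!`, neither of the two
  -- factorials.
  prime∣C : ∀ {p} → Prime p → ∀ k → 0 < k → k < p → p ∣ p C k
  prime∣C {p@(suc p-1)} pr k 0<k k<p with euclidsLemma (p C k) (k ! *ᴺ (p ∸ k) !) pr (subst (p ∣_) (sym e) (m∣m*n (p-1 !)))
    where
    instance _ = k ℕₚ.!* (p ∸ k) !≢0
    e : (p C k) *ᴺ (k ! *ᴺ (p ∸ k) !) ≡ p !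
    e = trans (cong (_*ᴺ (k ! *ᴺ (p ∸ k) !)) (nCk≡n!/k![n-k]! (ℕₚ.<⇒≤ k<p))) (m/n*n≡m (k![n∸k]!∣n! (ℕₚ.<⇒≤ k<p)))
  ... | inj₁ p∣C = p∣C
  ... | inj₂ p∣d with euclidsLemma (k !) ((p ∸ k) !) pr p∣d
  ... | inj₁ p∣ = ⊥-elim (prime∤! pr k k<p p∣)
  ... | inj₂ p∣ = ⊥-elim (prime∤! pr (p ∸ k) (ℕₚ.∸-monoʳ-< 0<k (ℕₚ.<⇒≤ k<p)) p∣)
  prime∣C {zero} pr k _ ()

  count≡1⇒Any : {A : Set} {P : A → Set} (P? : Decidable P) (xs : List A) → count P? xs ≡ 1 → Any P xs
  count≡1⇒Any P? (x ∷ xs) e with P? x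
  ... | yes p = here p
  ... | no  _ = there (count≡1⇒Any P? xs e)

  module _ {q : ℕ} (F : FieldOn q) where
    open MatrixAlgebra F
    open BlockMatrices F
    open ≐-Reasoning
    open Matrices F using (IsHom; isHom?; AddMod; numHom; allMats; IsInvertible)

    private variable
      n : ℕ

    opaque
      unfolding _∙_

      IsInvertible⇒ : {A : M n n} → IsInvertible A → ∃ λ B → A ∙ B ≐ 𝟏
      IsInvertible⇒ inv with Any.satisfied inv
      ... | B , e = B , entrywise e

      ⇒IsInvertible : {A : M n n} (B : M n n) → A ∙ B ≐ 𝟏 → IsInvertible A
      ⇒IsInvertible {n} {A} B AB = Any.map (λ B≐B′ → at (≐-trans (∙-congˡ A (≐-sym B≐B′)) AB))
        (count≡1⇒Any (B ≐?_) (Enum.elems (matᴱ n n)) (Enum.once (matᴱ n n) B))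

      IsHom-∙ : ∀ {m} {f : Fin m → M n n} → IsHom m n f → ∀ i j k → AddMod m i j k → f k ≐ f i ∙ f j
      IsHom-∙ (_ , h) i j k s = entrywise (h i j k s)

      ⇒IsHom : ∀ {m} {f : Fin m → M n n} → (∀ i → IsInvertible (f i)) →
               (∀ i j k → AddMod m i j k → f k ≐ f i ∙ f j) → IsHom m n f
      ⇒IsHom inv h = inv , λ i j k s → at (h i j k s)

    IsHom-resp : ∀ {m} {f g : Fin m → M n n} → (∀ i → f i ≐ g i) → IsHom m n f → IsHom m n g
    IsHom-resp {f = f} {g} e h@(inv , _) = ⇒IsHom
      (λ i → let B , fB = IsInvertible⇒ (inv i) in ⇒IsInvertible B (≐-trans (∙-congʳ B (≐-sym (e i))) fB))
      (λ i j k s → ≐-trans (≐-sym (e k)) (≐-trans (IsHom-∙ h i j k s) (∙-cong (e i) (e j))))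

    module _ {m-1 : ℕ} {f : Fin (suc m-1) → M n n} (h : IsHom (suc m-1) n f) where

      hom-zero : f zero ≐ 𝟏
      hom-zero with IsInvertible⇒ (proj₁ h zero)
      ... | B , fB = begin
        f zero                   ≈⟨ ∙-identityʳ (f zero) ⟨
        f zero ∙ 𝟏               ≈⟨ ∙-congˡ (f zero) fB ⟨
        f zero ∙ (f zero ∙ B)    ≈⟨ ∙-assoc (f zero) (f zero) B ⟨
        f zero ∙ f zero ∙ B      ≈⟨ ∙-congʳ B (IsHom-∙ h zero zero zero (inj₁ refl)) ⟨
        f zero ∙ B               ≈⟨ fB ⟩
        𝟏                        ∎

    -- 1 modulo suc k, which is 0 when k = 0.
    one : ∀ k → Fin (suc k)
    one zero    = zero
    one (suc _) = suc zero

    hom-power : ∀ k {f : Fin (suc k) → M n n} → IsHom (suc k) n f → ∀ i → f i ≐ f (one k) ^ toℕ i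
    hom-power zero    h zero = hom-zero h
    hom-power (suc k) {f} h  = <-weakInduction (λ i → f i ≐ f (suc zero) ^ toℕ i) (hom-zero h) λ i e →
      ≐-trans (IsHom-∙ h (suc zero) (inject₁ i) (suc i) (inj₁ (cong suc (toℕ-inject₁ i))))
        (∙-congˡ _ (≐-trans e (^-cong ≐-refl (toℕ-inject₁ i))))

    hom-order : ∀ k {f : Fin (suc k) → M n n} → IsHom (suc k) n f → f (one k) ^ suc k ≐ 𝟏
    hom-order zero    h = ≐-trans (∙-identityʳ _) (hom-zero h)
    hom-order (suc k) {f} h = begin
      f (suc zero) ∙ f (suc zero) ^ suc k
        ≈⟨ ∙-congˡ _ (^-cong ≐-refl (sym (toℕ-fromℕ (suc k)))) ⟩
      f (suc zero) ∙ f (suc zero) ^ toℕ (fromℕ (suc k))   ≈⟨ ∙-congˡ _ (hom-power (suc k) h (fromℕ (suc k))) ⟨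
      f (suc zero) ∙ f (fromℕ (suc k))
        -- Adding 1 to the largest residue wraps round to 0; this is the second alternative of
        -- `AddMod`.
        ≈⟨ IsHom-∙ h (suc zero) (fromℕ (suc k)) zero (inj₂ (cong suc (toℕ-fromℕ (suc k)))) ⟨
      f zero                                              ≈⟨ hom-zero h ⟩
      𝟏                                                   ∎

    powers-hom : ∀ k (A : M n n) → A ^ suc k ≐ 𝟏 → IsHom (suc k) n (λ i → A ^ toℕ i)
    powers-hom k A e = ⇒IsHom
      (λ i → ⇒IsInvertible (A ^ (suc k ∸ toℕ i)) (begin
        A ^ toℕ i ∙ A ^ (suc k ∸ toℕ i)     ≈⟨ ^-homo-* A (toℕ i) (suc k ∸ toℕ i) ⟨
        A ^ (toℕ i +ᴺ (suc k ∸ toℕ i))      ≈⟨ ^-cong ≐-refl (ℕₚ.m+[n∸m]≡n (ℕₚ.<⇒≤ (toℕ<n i))) ⟩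
        A ^ suc k                           ≈⟨ e ⟩
        𝟏                                   ∎))
      λ { i j l (inj₁ s) → ≐-trans (^-cong ≐-refl (sym s)) (^-homo-* A (toℕ i) (toℕ j))
        ; i j l (inj₂ s) → begin
            A ^ toℕ l                     ≈⟨ ∙-identityʳ _ ⟨
            A ^ toℕ l ∙ 𝟏                 ≈⟨ ∙-congˡ _ e ⟨
            A ^ toℕ l ∙ A ^ suc k         ≈⟨ ^-homo-* A (toℕ l) (suc k) ⟨
            A ^ (toℕ l +ᴺ suc k)          ≈⟨ ^-cong ≐-refl s ⟨
            A ^ (toℕ i +ᴺ toℕ j)          ≈⟨ ^-homo-* A (toℕ i) (toℕ j) ⟩
            A ^ toℕ i ∙ A ^ toℕ j         ∎ }

    one-power : ∀ k (A : M n n) → A ^ suc k ≐ 𝟏 → A ^ toℕ (one k) ≐ A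
    one-power zero    A e = ≐-trans (≐-sym e) (∙-identityʳ A)
    one-power (suc k) A e = ∙-identityʳ A

    -- A homomorphism is determined by the image of the generator `one k`, and any root of unity can
    -- occur: its complementary powers are the inverses that `IsHom` asks for.
    numHom≡roots : ∀ k n → numHom (suc k) n ≡ # (matᴱ n n) (λ A → A ^ suc k ≐? 𝟏)
    numHom≡roots k n = #-bij (funᴱ (suc k) (matᴱ n n)) (matᴱ n n) (isHom? (suc k) n) (λ A → A ^ suc k ≐? 𝟏)
      (λ f → f (one k)) (λ A i → A ^ toℕ i)
      IsHom-resp (λ e p → ≐-trans (^-congˡ (suc k) (≐-sym e)) p)
      (λ e → e (one k)) (λ e i → ^-congˡ (toℕ i) e)
      (hom-order k) (λ {A} → powers-hom k A)
      (λ h i → ≐-sym (hom-power k h i)) (λ {A} → one-power k A)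

  -- Characteristic p and the Frobenius map.

  module Characteristic {p v : ℕ} (pr : Prime p) (F : FieldOn (p ^ᴺ v)) where
    open MatrixAlgebra F
    open BlockMatrices F
    private
      module K = CommutativeRing fieldRing
      q = p ^ᴺ v
    open import Algebra.Properties.Semiring.Mult K.semiring as KMult using () renaming (_×_ to _×ᴷ_)
    open import Algebra.Properties.CommutativeMonoid.Sum K.+-commutativeMonoid using (sum; sum-permute; ∑-distrib-+; sum-replicate)
    open import Algebra.Properties.Ring K.ring using (+-cancelˡ)

    translation : Permutation q q
    translation = permutation (K._+ K.1#) (K._+ K.- K.1#)
      (λ x → trans (K.+-assoc x (K.- K.1#) K.1#) (trans (cong (x K.+_) (K.-‿inverseˡ K.1#)) (K.+-identityʳ x)))
      (λ x → trans (K.+-assoc x K.1# (K.- K.1#)) (trans (cong (x K.+_) (K.-‿inverseʳ K.1#)) (K.+-identityʳ x)))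

    -- Translation by 1 permutes the field, so it does not change the sum of all elements.
    q×1≡0 : q ×ᴷ K.1# ≡ K.0#
    q×1≡0 = +-cancelˡ (sum {q} id) (q ×ᴷ K.1#) K.0# (begin
      sum {q} id K.+ q ×ᴷ K.1#                 ≡⟨ cong (sum {q} id K.+_) (sum-replicate q) ⟨
      sum {q} id K.+ sum {q} (λ _ → K.1#)      ≡⟨ ∑-distrib-+ {q} id (λ _ → K.1#) ⟨
      sum {q} (K._+ K.1#)                      ≡⟨ sum-permute {q} id translation ⟨
      sum {q} id                               ≡⟨ K.+-identityʳ _ ⟨
      sum {q} id K.+ K.0#                      ∎)
      where open ≡-Reasoning

    -- If p times 1 were nonzero, it could be cancelled repeatedly from `q×1≡0`, down to 1 = 0.
    p×1≡0 : p ×ᴷ K.1# ≡ K.0#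
    p×1≡0 = descend v q×1≡0
      where
      descend : ∀ w → (p ^ᴺ w) ×ᴷ K.1# ≡ K.0# → p ×ᴷ K.1# ≡ K.0#
      descend zero    e = ⊥-elim (0≢1 (trans (sym e) (K.+-identityʳ K.1#)))
      descend (suc w) e with p ×ᴷ K.1# ≟ᶠ K.0#
      ... | yes z = z
      ... | no nz with inverse _ nz
      ... | y , e′ = descend w (begin
        z                           ≡⟨ K.*-identityˡ z ⟨
        K.1# K.* z                  ≡⟨ cong (K._* z) (trans (K.*-comm y x) e′) ⟨
        y K.* x K.* z               ≡⟨ K.*-assoc y x z ⟩
        y K.* (x K.* z)             ≡⟨ cong (y K.*_) (trans (sym (KMult.×1-homo-* p (p ^ᴺ w))) e) ⟩
        y K.* K.0#                  ≡⟨ K.zeroʳ y ⟩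
        K.0#                        ∎)
        where
        open ≡-Reasoning
        x = p ×ᴷ K.1#
        z = (p ^ᴺ w) ×ᴷ K.1#

    module _ {n : ℕ} where
      open import Algebra.Properties.Semiring.Mult (Ring.semiring (matrixRing n)) as MMult using () renaming (_×_ to _×ᴹ_)
      open import Algebra.Properties.CommutativeMonoid.Sum (Ring.+-commutativeMonoid (matrixRing n))
        using (sum-init-last; sum-cong-≋; sum-replicate-zero) renaming (sum to sumᴹ)
      open import Algebra.Properties.Ring (matrixRing n) using (+-cancelʳ)
      import Algebra.Properties.Semiring.Binomial (Ring.semiring (matrixRing n)) as Binomial

      opaque
        unfolding _∙_

        ×ᴹ-entry : ∀ k (A : M n n) i j → (k ×ᴹ A) i j ≡ k ×ᴷ A i j
        ×ᴹ-entry zero    A i j = refl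
        ×ᴹ-entry (suc k) A i j = cong (A i j K.+_) (×ᴹ-entry k A i j)

        p×A≐𝟎 : ∀ (A : M n n) → p ×ᴹ A ≐ 𝟎
        p×A≐𝟎 A .at i j = begin
          (p ×ᴹ A) i j                ≡⟨ ×ᴹ-entry p A i j ⟩
          p ×ᴷ A i j                  ≡⟨ cong (p ×ᴷ_) (K.*-identityˡ (A i j)) ⟨
          p ×ᴷ (K.1# K.* A i j)       ≡⟨ KMult.×-assoc-* p K.1# (A i j) ⟨
          (p ×ᴷ K.1#) K.* A i j       ≡⟨ cong (K._* A i j) p×1≡0 ⟩
          K.0# K.* A i j              ≡⟨ K.zeroˡ (A i j) ⟩
          K.0#                        ∎
          where open ≡-Reasoning

      open ≐-Reasoning

      𝟏-^ : ∀ k → 𝟏 {n} ^ k ≐ 𝟏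
      𝟏-^ zero    = ≐-refl
      𝟏-^ (suc k) = ≐-trans (∙-identityˡ _) (𝟏-^ k)

      -- `N` commutes with `𝟏`, so the binomial theorem applies, and by `prime∣C` every inner term
      -- is a multiple of p.
      freshman : (N : M n n) → (N ⊕ 𝟏) ^ p ≐ N ^ p ⊕ 𝟏
      freshman N = expansion p refl
        where
        open Binomial N 𝟏 using (binomialTerm; theorem)
        expansion : ∀ p′ → p′ ≡ p → (N ⊕ 𝟏) ^ p′ ≐ N ^ p′ ⊕ 𝟏
        expansion zero    refl = ⊥-elim (ℕ.≢-nonZero⁻¹ _ {{prime⇒nonZero pr}} refl)
        expansion p′@(suc p-1) refl = begin
          (N ⊕ 𝟏) ^ p                                     ≈⟨ theorem (≐-trans (∙-identityʳ N) (≐-sym (∙-identityˡ N))) p ⟩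
          t zero ⊕ sumᴹ (λ k → t (suc k))                 ≈⟨ ⊕-cong first (sum-init-last (λ k → t (suc k))) ⟩
          𝟏 ⊕ (sumᴹ (λ k → t (suc (inject₁ k))) ⊕ t (suc (fromℕ p-1)))
            ≈⟨ ⊕-cong ≐-refl (⊕-cong (≐-trans (sum-cong-≋ middle) (sum-replicate-zero p-1)) last) ⟩
          𝟏 ⊕ (𝟎 ⊕ N ^ p)                                 ≈⟨ ⊕-cong ≐-refl (⊕-identityˡ _) ⟩
          𝟏 ⊕ N ^ p                                       ≈⟨ ⊕-comm _ _ ⟩
          N ^ p ⊕ 𝟏                                       ∎
          where
          t = binomialTerm p
          first : t zero ≐ 𝟏
          first = begin
            (p C 0) ×ᴹ (𝟏 ∙ 𝟏 ^ p)    ≈⟨ MMult.×-congˡ {𝟏 ∙ 𝟏 ^ p} (trans (nCk≡nC[n∸k] {0} {p} z≤n) (nCn≡1 p)) ⟩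
            1 ×ᴹ (𝟏 ∙ 𝟏 ^ p)          ≈⟨ MMult.×-homo-1 _ ⟩
            𝟏 ∙ 𝟏 ^ p                 ≈⟨ ∙-identityˡ _ ⟩
            𝟏 ^ p                     ≈⟨ 𝟏-^ p ⟩
            𝟏                         ∎
          last : t (suc (fromℕ p-1)) ≐ N ^ p
          last = begin
            (p C k) ×ᴹ (N ^ k ∙ 𝟏 ^ (p ∸ k))   ≈⟨ MMult.×-congˡ {N ^ k ∙ 𝟏 ^ (p ∸ k)} (trans (cong (p C_) k≡p) (nCn≡1 p)) ⟩
            1 ×ᴹ (N ^ k ∙ 𝟏 ^ (p ∸ k))         ≈⟨ MMult.×-homo-1 _ ⟩
            N ^ k ∙ 𝟏 ^ (p ∸ k)                ≈⟨ ∙-cong (^-cong ≐-refl k≡p) (𝟏-^ (p ∸ k)) ⟩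
            N ^ p ∙ 𝟏                          ≈⟨ ∙-identityʳ _ ⟩
            N ^ p                              ∎
            where
            k = toℕ (suc (fromℕ p-1))
            k≡p : k ≡ p
            k≡p = cong suc (toℕ-fromℕ p-1)
          middle : ∀ i → t (suc (inject₁ i)) ≐ 𝟎
          middle i with prime∣C pr (toℕ (suc (inject₁ i))) (s≤s z≤n)
                          (s≤s (subst (_< p-1) (sym (toℕ-inject₁ i)) (toℕ<n i)))
          ... | divides c e = begin
            (p C toℕ (suc (inject₁ i))) ×ᴹ z   ≈⟨ MMult.×-congˡ {z} (trans e (ℕₚ.*-comm c p)) ⟩
            (p *ᴺ c) ×ᴹ z                      ≈⟨ MMult.×-assocˡ z p c ⟨
            p ×ᴹ (c ×ᴹ z)                      ≈⟨ p×A≐𝟎 (c ×ᴹ z) ⟩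
            𝟎                                  ∎
            where z = Binomial.binomial N 𝟏 p (suc (inject₁ i))

      frobenius : ∀ u (N : M n n) → (N ⊕ 𝟏) ^ (p ^ᴺ u) ≐ N ^ (p ^ᴺ u) ⊕ 𝟏
      frobenius zero    N = ≐-trans (∙-identityʳ _) (⊕-cong (≐-sym (∙-identityʳ N)) ≐-refl)
      frobenius (suc u) N = begin
        (N ⊕ 𝟏) ^ (p *ᴺ p ^ᴺ u)      ≈⟨ ^-assocʳ (N ⊕ 𝟏) p (p ^ᴺ u) ⟨
        ((N ⊕ 𝟏) ^ p) ^ (p ^ᴺ u)     ≈⟨ ^-congˡ (p ^ᴺ u) (freshman N) ⟩
        (N ^ p ⊕ 𝟏) ^ (p ^ᴺ u)       ≈⟨ frobenius u (N ^ p) ⟩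
        (N ^ p) ^ (p ^ᴺ u) ⊕ 𝟏       ≈⟨ ⊕-cong (^-assocʳ N p (p ^ᴺ u)) ≐-refl ⟩
        N ^ (p *ᴺ p ^ᴺ u) ⊕ 𝟏        ∎

      roots≡nilpotents : ∀ u → # (matᴱ n n) (λ A → A ^ (p ^ᴺ u) ≐? 𝟏) ≡ # (matᴱ n n) (λ N → N ^ (p ^ᴺ u) ≐? 𝟎)
      roots≡nilpotents u = #-bij (matᴱ n n) (matᴱ n n) _ _ (_⊖ 𝟏) (_⊕ 𝟏)
        (λ e h → ≐-trans (^-congˡ (p ^ᴺ u) (≐-sym e)) h) (λ e h → ≐-trans (^-congˡ (p ^ᴺ u) (≐-sym e)) h)
        (λ e → ⊕-cong e ≐-refl) (λ e → ⊕-cong e ≐-refl)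
        (λ {A} h → +-cancelʳ 𝟏 _ 𝟎 (begin
          (A ⊖ 𝟏) ^ (p ^ᴺ u) ⊕ 𝟏     ≈⟨ frobenius u (A ⊖ 𝟏) ⟨
          (A ⊖ 𝟏 ⊕ 𝟏) ^ (p ^ᴺ u)     ≈⟨ ^-congˡ (p ^ᴺ u) (⊖⊕-cancel A 𝟏) ⟩
          A ^ (p ^ᴺ u)               ≈⟨ h ⟩
          𝟏                          ≈⟨ ⊕-identityˡ 𝟏 ⟨
          𝟎 ⊕ 𝟏                      ∎))
        (λ {N} h → begin
          (N ⊕ 𝟏) ^ (p ^ᴺ u)         ≈⟨ frobenius u N ⟩
          N ^ (p ^ᴺ u) ⊕ 𝟏           ≈⟨ ⊕-cong h ≐-refl ⟩
          𝟎 ⊕ 𝟏                      ≈⟨ ⊕-identityˡ 𝟏 ⟩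
          𝟏                          ∎)
        (λ {A} _ → ⊖⊕-cancel A 𝟏) (λ {N} _ → ⊕⊖-cancel N 𝟏)

    numHom≡nilpotents : ∀ u n {m-1} → p ^ᴺ u ≡ suc m-1 → Matrices.numHom F (p ^ᴺ u) n ≡ NilpotentCounts.nilpotents F m-1 n
    numHom≡nilpotents u n e = go (p ^ᴺ u) e (roots≡nilpotents {n} u)
      where
      opaque
        unfolding NilpotentCounts.nilpotents

        go : ∀ m {m-1} → m ≡ suc m-1 →
             # (matᴱ n n) (λ A → A ^ m ≐? 𝟏) ≡ # (matᴱ n n) (λ N → N ^ m ≐? 𝟎) →
             Matrices.numHom F m n ≡ NilpotentCounts.nilpotents F m-1 n
        go _ refl h = trans (numHom≡roots F _ n) h

-- The exponent arithmetic and the calculus of valuation bounds.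

module Valuations where
  open import Data.Nat
  open import Data.Nat.Properties
  open import Data.Nat.Divisibility
  open import Data.Nat.Primality using (Prime; euclidsLemma; prime⇒nonTrivial; prime⇒nonZero)
  open import Data.Nat.Tactic.RingSolver using (solve-∀)

  vpFrom-∣ : ∀ p N k → p ^ vpFrom p N k ∣ N
  vpFrom-∣ p N zero = 1∣ N
  vpFrom-∣ p N (suc k) with (p ^ suc k) ∣? N
  ... | yes d = d
  ... | no  _ = vpFrom-∣ p N k

  vpFrom-≥ : ∀ p N k {e} → p ^ e ∣ N → e ≤ k → e ≤ vpFrom p N k
  vpFrom-≥ p N zero    d e≤k = e≤k
  vpFrom-≥ p N (suc k) {e} d e≤k with (p ^ suc k) ∣? N
  ... | yes _ = e≤k
  ... | no ∤N = vpFrom-≥ p N k d (s≤s⁻¹ (≤∧≢⇒< e≤k λ { refl → ∤N d }))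

  n<p^n : ∀ {p} → 1 < p → ∀ n → n < p ^ n
  n<p^n {p} 1<p zero    = s≤s z≤n
  n<p^n {p} 1<p (suc n) = begin-strict
    suc n           ≡⟨ +-comm 1 n ⟩
    n + 1           <⟨ +-monoˡ-< 1 (n<p^n 1<p n) ⟩
    p ^ n + 1       ≤⟨ +-monoʳ-≤ (p ^ n) (≤-trans (s≤s z≤n) (n<p^n 1<p n)) ⟩
    p ^ n + p ^ n   ≡⟨ cong (p ^ n +_) (+-identityʳ (p ^ n)) ⟨
    2 * p ^ n       ≤⟨ *-monoˡ-≤ (p ^ n) 1<p ⟩
    p * p ^ n       ∎
    where open ≤-Reasoning

  -- The search in `vp` only tries exponents up to `N`; this loses nothing, as `e < p ^ e` and
  -- `p ^ e ≤ N`.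
  ∣⇒≤vp : ∀ {p N e} → 1 < p → 0 < N → p ^ e ∣ N → e ≤ vp p N
  ∣⇒≤vp {p} {N} {e} 1<p 0<N d = vpFrom-≥ p N N d
    (≤-trans (<⇒≤ (n<p^n 1<p e)) (∣⇒≤ {{>-nonZero 0<N}} d))

  -- The binomial coefficient n over 2, in the recursive form that the inductions use.
  triangle : ℕ → ℕ
  triangle zero    = 0
  triangle (suc n) = n + triangle n

  2*triangle : ∀ n → 2 * triangle (suc n) ≡ n * suc n
  2*triangle zero    = refl
  2*triangle (suc n) = trans (lemma n (triangle (suc n))) (trans (cong (2 * suc n +_) (2*triangle n)) (lemma′ n))
    where
    lemma : ∀ n t → 2 * (suc n + t) ≡ 2 * suc n + 2 * t
    lemma = solve-∀
    lemma′ : ∀ n → 2 * suc n + n * suc n ≡ suc n * suc (suc n)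
    lemma′ = solve-∀

  -- Both sides are the maximum of `i` and `k`. It lets `exponent-balance` trade one truncated
  -- difference for the other once `k * n` is added to both sides.
  ∸-swap : ∀ i k → (k ∸ i) + i ≡ (i ∸ k) + k
  ∸-swap zero    k       = trans (+-identityʳ k) (cong (_+ k) (sym (0∸n≡0 k)))
  ∸-swap (suc i) zero    = sym (+-identityʳ (suc i))
  ∸-swap (suc i) (suc k) = trans (+-suc (k ∸ i) i) (trans (cong suc (∸-swap i k)) (sym (+-suc (i ∸ k) k)))

  -- Exponent of q in the number of pairs (N , v) with v of order suc i in dimension suc i + n.
  exponent : ℕ → ℕ → ℕ
  exponent zero    n = 0
  exponent (suc i) n = exponent i n + (suc i + n)

  exponent-closed : ∀ i n → exponent i n ≡ triangle (suc i) + i * n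
  exponent-closed zero    n = refl
  exponent-closed (suc i) n = trans (cong (_+ (suc i + n)) (exponent-closed i n)) (lemma i n (triangle (suc i)))
    where
    lemma : ∀ i n t → t + i * n + (suc i + n) ≡ suc i + t + suc i * n
    lemma = solve-∀

  triangle-+ : ∀ i n → triangle (i + n) ≡ triangle n + i * n + triangle i
  triangle-+ zero    n = sym (trans (+-identityʳ _) (+-identityʳ _))
  triangle-+ (suc i) n = trans (cong (i + n +_) (triangle-+ i n)) (lemma i n (triangle n) (triangle i))
    where
    lemma : ∀ i n t s → i + n + (t + i * n + s) ≡ t + suc i * n + (i + s)
    lemma = solve-∀

  -- With m = suc (i + k) this compares (m - 1) C(n,2) in dimensions suc i + n and n.
  exponent-balance : ∀ i k n →
    (i + k) * triangle (suc i + n) + (i ∸ k) * n + i * suc i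
    ≡ (i + k) * triangle n + (k ∸ i) * n + suc (suc (i + k)) * exponent i n
  exponent-balance i k n = +-cancelʳ-≡ (k * n) _ _ (begin
    (i + k) * triangle (suc i + n) + (i ∸ k) * n + i * suc i + k * n
      ≡⟨ cong₂ (λ x y → (i + k) * x + (i ∸ k) * n + y + k * n) (triangle-+ (suc i) n) (sym (2*triangle i)) ⟩
    (i + k) * (triangle n + suc i * n + t) + (i ∸ k) * n + 2 * t + k * n
      ≡⟨ collect i k n (triangle n) t (i ∸ k) ⟩
    (i + k) * (triangle n + suc i * n + t) + ((i ∸ k) + k) * n + 2 * t
      ≡⟨ cong (λ x → (i + k) * (triangle n + suc i * n + t) + x * n + 2 * t) (∸-swap i k) ⟨
    (i + k) * (triangle n + suc i * n + t) + ((k ∸ i) + i) * n + 2 * t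
      ≡⟨ expand i k n (triangle n) t (k ∸ i) ⟩
    (i + k) * triangle n + (k ∸ i) * n + suc (suc (i + k)) * (t + i * n) + k * n
      ≡⟨ cong (λ x → (i + k) * triangle n + (k ∸ i) * n + suc (suc (i + k)) * x + k * n) (exponent-closed i n) ⟨
    (i + k) * triangle n + (k ∸ i) * n + suc (suc (i + k)) * exponent i n + k * n ∎)
    where
    open ≡-Reasoning
    t = triangle (suc i)
    collect : ∀ i k n s t d → (i + k) * (s + suc i * n + t) + d * n + 2 * t + k * n
                            ≡ (i + k) * (s + suc i * n + t) + (d + k) * n + 2 * t
    collect = solve-∀
    expand : ∀ i k n s t d → (i + k) * (s + suc i * n + t) + (d + i) * n + 2 * t
                           ≡ (i + k) * s + d * n + suc (suc (i + k)) * (t + i * n) + k * n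
    expand = solve-∀

  -- Bound E X says v_p(X) ≥ v E / (m + 1), and Strict and Sharp are the cases > and =.
  module Valuation {p : ℕ} (pr : Prime p) (v m : ℕ) where
    private
      instance _ = prime⇒nonZero pr
      q = p ^ v

    Bound Strict Sharp : ℕ → ℕ → Set
    Bound  E X = ∃ λ e → p ^ e ∣ X × v * E ≤ suc m * e
    Strict E X = ∃ λ e → p ^ e ∣ X × v * E < suc m * e
    Sharp  E X = ∃ λ e → ∃ λ w → X ≡ p ^ e * w × ¬ p ∣ w × suc m * e ≡ v * E

    private variable
      E E′ X Y Z U : ℕ

    p^-mono-∣ : ∀ {d e} → d ≤ e → p ^ e ∣ X → p ^ d ∣ X
    p^-mono-∣ d≤e = ∣-trans (m≤n⇒m^n∣ d≤e)
      where
      m≤n⇒m^n∣ : ∀ {d e} → d ≤ e → p ^ d ∣ p ^ e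
      m≤n⇒m^n∣ {d} {e} d≤e = subst (λ x → p ^ d ∣ p ^ x) (m+[n∸m]≡n d≤e)
        (subst (p ^ d ∣_) (sym (^-distribˡ-+-* p d (e ∸ d))) (m∣m*n (p ^ (e ∸ d))))

    q^k : ∀ k → q ^ k ≡ p ^ (v * k)
    q^k k = ^-*-assoc p v k

    common : Bound E X → Bound E Y → ∃ λ e → p ^ e ∣ X × p ^ e ∣ Y × v * E ≤ suc m * e
    common (d , a , f) (e , b , g) with ≤-total d e
    ... | inj₁ d≤e = d , a , p^-mono-∣ d≤e b , f
    ... | inj₂ e≤d = e , p^-mono-∣ e≤d a , b , g

    bound-+ : Bound E X → Bound E Y → Bound E (X + Y)
    bound-+ a b with common a b
    ... | e , x , y , f = e , ∣m∣n⇒∣m+n x y , f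

    bound-∸ : Bound E (X + Y) → Bound E Y → Bound E X
    bound-∸ {X = X} {Y} a b with common a b
    ... | e , z , y , f = e , ∣m+n∣m⇒∣n (subst (p ^ e ∣_) (+-comm X Y) z) y , f

    bound-weaken : E′ ≤ E → Bound E X → Bound E′ X
    bound-weaken E′≤E (e , x , f) = e , x , ≤-trans (*-monoʳ-≤ v E′≤E) f

    bound-*ˡ : ∀ U → Bound E X → Bound E (U * X)
    bound-*ˡ U (e , x , f) = e , ∣n⇒∣m*n U x , f

    bound-0 : ∀ E → Bound E 0
    -- Every power of p divides 0; the exponent `v * E` is simply large enough.
    bound-0 E = v * E , (_ ∣0) , m≤m+n (v * E) (m * (v * E))

    private
      scale : ∀ v m E k e → v * (E + suc m * k) ≡ v * E + suc m * (v * k)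
      scale = solve-∀

    bound-q^ : ∀ k → Bound E X → Bound (E + suc m * k) (q ^ k * X)
    bound-q^ {E} {X} k (e , x , f) = v * k + e
      , subst₂ _∣_ (sym (^-distribˡ-+-* p (v * k) e)) (cong (_* X) (sym (q^k k))) (*-monoʳ-∣ (p ^ (v * k)) x)
      , (begin
        v * (E + suc m * k)             ≡⟨ scale v m E k e ⟩
        v * E + suc m * (v * k)         ≤⟨ +-monoˡ-≤ _ f ⟩
        suc m * e + suc m * (v * k)     ≡⟨ +-comm (suc m * e) _ ⟩
        suc m * (v * k) + suc m * e     ≡⟨ *-distribˡ-+ (suc m) (v * k) e ⟨
        suc m * (v * k + e)             ∎)
      where open ≤-Reasoning

    p^∣-unit : ¬ p ∣ U → ∀ e X → p ^ e ∣ U * X → p ^ e ∣ X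
    p^∣-unit         p∤U zero    X d = 1∣ X
    p^∣-unit {U = U} p∤U (suc e) X d with euclidsLemma U X pr (∣-trans (m∣m*n (p ^ e)) d)
    ... | inj₁ p∣U = ⊥-elim (p∤U p∣U)
    ... | inj₂ (divides Y refl) = subst (p ^ suc e ∣_) (*-comm p Y) (*-monoʳ-∣ p
            (p^∣-unit p∤U e Y (*-cancelˡ-∣ p (subst (p ^ suc e ∣_) (lemma U Y p) d))))
      where
      lemma : ∀ U Y p → U * (Y * p) ≡ p * (U * Y)
      lemma = solve-∀

    bound-unit : ¬ p ∣ U → Bound E (U * X) → Bound E X
    bound-unit p∤U (e , d , f) = e , p^∣-unit p∤U e _ d , f

    strict-of-bound : 0 < v → E < E′ → Bound E′ X → Strict E X
    strict-of-bound 0<v E<E′ (e , d , f) = e , d , <-≤-trans (*-monoʳ-< v {{>-nonZero 0<v}} E<E′) f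

    -- When the bound is attained by the integer `e`, exceeding it gives at least one further factor
    -- p.
    strict⇒∣ : ∀ {e} → suc m * e ≡ v * E → Strict E X → p ^ suc e ∣ X
    strict⇒∣ {e = e} g (d , x , f) = p^-mono-∣ (*-cancelˡ-< (suc m) e d (subst (_< suc m * d) (sym g) f)) x

    sharp-+ : Sharp E X → Strict E Y → Sharp E (X + Y)
    sharp-+ (e , w , refl , p∤w , g) s with strict⇒∣ g s
    ... | divides y refl = e , w + y * p , lemma (p ^ e) w y p , (λ d → p∤w (∣m+n∣m⇒∣n (subst (p ∣_) (+-comm w _) d) (n∣m*n y))) , g
      where
      lemma : ∀ P w y p → P * w + y * (p * P) ≡ P * (w + y * p)
      lemma = solve-∀

    -- Modulo the next power of p the sum `Z` vanishes, so `X` is congruent to the negative of `Y`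
    -- and has the same valuation.
    sharp-∸ : X + Y ≡ Z → Sharp E Y → Strict E Z → Sharp E X
    sharp-∸ {X} {Z = Z} x+y≡z (e , w , refl , p∤w , g) s
      with ∣m+n∣m⇒∣n (subst (p ^ e ∣_) (trans (sym x+y≡z) (+-comm X _)) (p^-mono-∣ (n≤1+n e) (strict⇒∣ g s))) (m∣m*n w)
    ... | divides x refl = e , x , *-comm x (p ^ e) , (λ p∣x → p∤w (∣m+n∣m⇒∣n p∣x+w p∣x)) , g
      where
      p∣x+w : p ∣ x + w
      p∣x+w = *-cancelˡ-∣ (p ^ e) {{m^n≢0 p e}}
        (subst₂ _∣_ (*-comm p (p ^ e)) (trans (sym x+y≡z) (lemma x (p ^ e) w)) (strict⇒∣ g s))
        where
        lemma : ∀ x P w → x * P + P * w ≡ P * (x + w)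
        lemma = solve-∀

    sharp-*-unit : ¬ p ∣ U → Sharp E X → Sharp E (U * X)
    sharp-*-unit {U} p∤U (e , w , refl , p∤w , g) = e , U * w , lemma U (p ^ e) w , p∤Uw , g
      where
      lemma : ∀ U P w → U * (P * w) ≡ P * (U * w)
      lemma = solve-∀
      p∤Uw : ¬ p ∣ U * w
      p∤Uw d with euclidsLemma U w pr d
      ... | inj₁ a = p∤U a
      ... | inj₂ b = p∤w b

    sharp-unit : ¬ p ∣ U → Sharp E (U * X) → Sharp E X
    sharp-unit {U} {X = X} p∤U (e , w , eq , p∤w , g) with p^∣-unit p∤U e X (divides w (trans eq (*-comm (p ^ e) w)))
    ... | divides x refl = e , x , *-comm x (p ^ e) , (λ p∣x → p∤w (subst (p ∣_) Ux≡w (∣n⇒∣m*n U p∣x))) , g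
      where
      Ux≡w : U * x ≡ w
      Ux≡w = *-cancelˡ-≡ (U * x) w (p ^ e) {{m^n≢0 p e}} (trans (lemma (p ^ e) U x) eq)
        where
        lemma : ∀ P U x → P * (U * x) ≡ U * (x * P)
        lemma = solve-∀

    sharp-q^ : ∀ k → Sharp E X → Sharp (E + suc m * k) (q ^ k * X)
    sharp-q^ {E} k (e , w , refl , p∤w , g) = v * k + e , w , q-part , p∤w , exponents
      where
      open ≡-Reasoning
      q-part : q ^ k * (p ^ e * w) ≡ p ^ (v * k + e) * w
      q-part = begin
        q ^ k * (p ^ e * w)            ≡⟨ *-assoc (q ^ k) (p ^ e) w ⟨
        q ^ k * p ^ e * w              ≡⟨ cong (λ x → x * p ^ e * w) (q^k k) ⟩
        p ^ (v * k) * p ^ e * w        ≡⟨ cong (_* w) (^-distribˡ-+-* p (v * k) e) ⟨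
        p ^ (v * k + e) * w            ∎
      exponents : suc m * (v * k + e) ≡ v * (E + suc m * k)
      exponents = begin
        suc m * (v * k + e)              ≡⟨ *-distribˡ-+ (suc m) (v * k) e ⟩
        suc m * (v * k) + suc m * e      ≡⟨ cong (suc m * (v * k) +_) g ⟩
        suc m * (v * k) + v * E          ≡⟨ +-comm (suc m * (v * k)) _ ⟩
        v * E + suc m * (v * k)          ≡⟨ scale v m E k e ⟨
        v * (E + suc m * k)              ∎

    bound⇒vp : 0 < X → Bound E X → v * E ≤ suc m * vp p X
    bound⇒vp 0<X (e , d , f) = ≤-trans f (*-monoʳ-≤ (suc m) (∣⇒≤vp (nonTrivial⇒n>1 p {{prime⇒nonTrivial pr}}) 0<X d))

    sharp⇒vp : 0 < X → Sharp E X → suc m * vp p X ≡ v * E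
    sharp⇒vp {X} 0<X (e , w , eq , p∤w , g) = trans (cong (suc m *_) (≤-antisym vp≤e
        (∣⇒≤vp (nonTrivial⇒n>1 p {{prime⇒nonTrivial pr}}) 0<X (divides w (trans eq (*-comm (p ^ e) w)))))) g
      where
      vp≤e : vp p X ≤ e
      vp≤e = ≮⇒≥ λ e<vp → p∤w (*-cancelˡ-∣ (p ^ e) {{m^n≢0 p e}}
        (subst₂ _∣_ (*-comm p (p ^ e)) eq (p^-mono-∣ e<vp (vpFrom-∣ p X X))))

open Counting
open import Data.Nat
open import Data.Nat.Properties
open import Data.Nat.Divisibility
open import Data.Nat.DivMod using (m≡m%n+[m/n]*n)
open import Data.Nat.Induction using (<-rec)
open import Data.Nat.Primality using (Prime; euclidsLemma; prime⇒nonTrivial; prime⇒nonZero)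
open import Data.Nat.Combinatorics using (_C_; nCk+nC[k+1]≡[n+1]C[k+1]; nC1≡n)
open import Data.Nat.Tactic.RingSolver using (solve-∀)
open import Data.List.Properties using (filter-some)
import Data.List.Relation.Unary.Any as Any
open Homomorphisms using (count≡1⇒Any; module Characteristic)
open Valuations

-- Closed formulas for the differences, the growth bounds, and the sharp cases.

module Growth {p : ℕ} (pr : Prime p) (v : ℕ) (0<v : 0 < v) (F : FieldOn (p ^ v)) (m-1 : ℕ) where
  open MatrixAlgebra F using (_≐?_; ≐-trans; ≐-sym; 𝟎; 𝟏₁≢𝟎; ∙-empty; M₀≐𝟎) renaming (_^_ to _^ᴹ_)
  open BlockMatrices F using (matᴱ; card-matᴱ; 𝟎-∙)
  open NilpotentCounts F m-1
  open DimensionRecursion F m-1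
  private
    m = suc m-1
    q = p ^ v
    instance
      p≢0 = prime⇒nonZero pr
      q≢0 : NonZero q
      q≢0 = m^n≢0 p v
  open Valuation pr v m

  1<p : 1 < p
  1<p = nonTrivial⇒n>1 p {{prime⇒nonTrivial pr}}

  -- As `0 < v`, p divides `q ^ suc n`; dividing its predecessor too would make it divide 1. The
  -- shift to `suc n` matters, since `q ^ 0 ∸ 1` is 0.
  p∤q^-1 : ∀ n → ¬ p ∣ q ^ suc n ∸ 1
  p∤q^-1 n d = <⇒≱ 1<p (∣⇒≤ (∣m+n∣m⇒∣n (subst (p ∣_) (sym (m∸n+n≡m (m^n>0 q (suc n)))) p∣q^) d))
    where
    p∣q : p ∣ q
    p∣q = subst (λ w → p ∣ p ^ w) (m+[n∸m]≡n 0<v) (m∣m*n (p ^ (v ∸ 1)))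
    p∣q^ : p ∣ q ^ suc n
    p∣q^ = ∣-trans p∣q (m∣m*n (q ^ n))

  opaque
    unfolding order dual

    order-0 : ∀ i → order i 0 ≡ 0
    order-0 i = count-none (order? i 0) (λ _ (_ , _ , ne) → ne (M₀≐𝟎 _)) (Enum.elems (matᴱ 0 0 ⊗ᴱ matᴱ 0 1))

    dual-0 : ∀ i j → dual i j 0 ≡ 0
    dual-0 i j = count-none (dual? i j 0)
      (λ ((N , v) , r) (_ , _ , e , _) → 𝟏₁≢𝟎 (≐-trans (≐-sym e) (∙-empty r _))) (Enum.elems (tripleᴱ 0))

  dual-suc : ∀ i j n → j ≤ m-1 → dual (suc i) (suc j) (suc n) ≡ (q ^ suc n ∸ 1) * (q * q ^ n * dual i j n)
  dual-suc i j n j≤ = trans (dual-fibres (suc i) (suc j) n) (cong ((q ^ suc n ∸ 1) *_) (dualAt-suc i j n j≤))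

  dual-one : ∀ j n → j ≤ m-1 → dual 0 (suc j) (suc n) ≡ (q ^ suc n ∸ 1) * (q ^ n * killed j n)
  dual-one j n j≤ = trans (dual-fibres 0 (suc j) n)
    (cong ((q ^ suc n ∸ 1) *_) (trans (dualAt-zero j n j≤) (cong (q ^ n *_) (sym (killed-transpose j n)))))

  -- A chain of `suc i` independent vectors does not fit into dimension `n ≤ i`: the recursion
  -- reaches dimension 0, where no row pairs to 1.
  dual-small : ∀ {i j n} → n ≤ i → i < j → j ≤ m → dual i j n ≡ 0
  dual-small {i} {j} z≤n _ _ = dual-0 i j
  dual-small {suc i} {suc j} {suc n} (s≤s n≤i) (s≤s i<j) (s≤s j≤) = begin
    dual (suc i) (suc j) (suc n)                     ≡⟨ dual-suc i j n j≤ ⟩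
    (q ^ suc n ∸ 1) * (q * q ^ n * dual i j n)
      ≡⟨ cong (λ x → (q ^ suc n ∸ 1) * (q * q ^ n * x)) (dual-small n≤i i<j (≤-trans j≤ (n≤1+n m-1))) ⟩
    (q ^ suc n ∸ 1) * (q * q ^ n * 0)                ≡⟨ cong ((q ^ suc n ∸ 1) *_) (*-zeroʳ (q * q ^ n)) ⟩
    (q ^ suc n ∸ 1) * 0                              ≡⟨ *-zeroʳ (q ^ suc n ∸ 1) ⟩
    0                                                ∎
    where open ≡-Reasoning

  -- `U` is a product of factors `q ^ d ∸ 1`, one for each dimension split off. The power
  -- `q ^ (i + n)` is kept apart from `q ^ exponent i n` because it cancels against the number of
  -- rows in `order-dual`.
  dual-formula : ∀ i j n → suc i + j ≤ m →
    ∃ λ U → ¬ p ∣ U × dual i (suc i + j) (suc i + n) ≡ U * (q ^ (i + n) * (q ^ exponent i n * killed j n))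
  dual-formula zero    j n (s≤s j≤) = _ , p∤q^-1 n ,
    trans (dual-one j n j≤) (cong (λ x → (q ^ suc n ∸ 1) * (q ^ n * x)) (sym (*-identityˡ (killed j n))))
  dual-formula (suc i) j n (s≤s j≤) with dual-formula i j n (≤-trans j≤ (n≤1+n m-1))
  ... | U , p∤U , e = (q ^ suc N ∸ 1) * U , p∤* , (begin
      dual (suc i) (suc (suc i + j)) (suc N)
        ≡⟨ dual-suc i (suc i + j) N j≤ ⟩
      (q ^ suc N ∸ 1) * (q * q ^ N * dual i (suc i + j) N)
        ≡⟨ cong (λ x → (q ^ suc N ∸ 1) * (q * q ^ N * x)) e ⟩
      (q ^ suc N ∸ 1) * (q * q ^ N * (U * (q ^ (i + n) * (q ^ exponent i n * K))))
        ≡⟨ shuffle (q ^ suc N ∸ 1) q (q ^ N) U (q ^ (i + n)) (q ^ exponent i n) K ⟩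
      (q ^ suc N ∸ 1) * U * (q ^ suc (i + n) * (q ^ exponent i n * q ^ N * K))
        ≡⟨ cong (λ x → (q ^ suc N ∸ 1) * U * (q ^ suc (i + n) * (x * K))) (^-distribˡ-+-* q (exponent i n) N) ⟨
      (q ^ suc N ∸ 1) * U * (q ^ suc (i + n) * (q ^ exponent (suc i) n * K)) ∎)
    where
    open ≡-Reasoning
    N = suc i + n
    K = killed j n
    shuffle : ∀ a q b u c d k → a * (q * b * (u * (c * (d * k)))) ≡ a * u * (q * c * (d * b * k))
    shuffle = solve-∀
    p∤* : ¬ p ∣ (q ^ suc N ∸ 1) * U
    p∤* d with euclidsLemma (q ^ suc N ∸ 1) U pr d
    ... | inj₁ a = p∤q^-1 N a
    ... | inj₂ b = p∤U b

  order-small : ∀ {i n} → n ≤ i → i < m → order i n ≡ 0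
  order-small {i} {zero}  n≤i i<m = order-0 i
  order-small {i} {suc n} n≤i i<m = m*n≡0⇒m≡0 (order i (suc n)) (q ^ n) {{m^n≢0 q n}}
    (trans (order-dual i n) (dual-small n≤i i<m ≤-refl))

  order-formula : ∀ i j n → suc i + j ≡ m →
    ∃ λ U → ¬ p ∣ U × order i (suc i + n) ≡ U * (q ^ exponent i n * killed j n)
  order-formula i j n e with dual-formula i j n (≤-reflexive e)
  ... | U , p∤U , f = U , p∤U , *-cancelˡ-≡ _ _ (q ^ (i + n)) {{m^n≢0 q (i + n)}} (begin
      q ^ (i + n) * order i (suc i + n)                              ≡⟨ *-comm (q ^ (i + n)) _ ⟩
      order i (suc i + n) * q ^ (i + n)                              ≡⟨ order-dual i (i + n) ⟩
      dual i m (suc i + n)                                           ≡⟨ cong (λ x → dual i x (suc i + n)) e ⟨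
      dual i (suc i + j) (suc i + n)                                 ≡⟨ f ⟩
      U * (q ^ (i + n) * (q ^ exponent i n * killed j n))            ≡⟨ shuffle U (q ^ (i + n)) _ ⟩
      q ^ (i + n) * (U * (q ^ exponent i n * killed j n))            ∎)
    where
    open ≡-Reasoning
    shuffle : ∀ a b c → a * (b * c) ≡ b * (a * c)
    shuffle = solve-∀

  -- The exponent claimed by the theorem, multiplied by `suc m` and divided by `v`, as `Bound`
  -- expects it.
  B : ℕ → ℕ
  B n = m-1 * triangle n

  -- The excess of v_p(killed j n) over the bound for nilpotents grows linearly in n with this slope / (m + 1).
  slope : ℕ → ℕ
  slope j = suc (j + j) ∸ m

  slope-order : ∀ i k → suc i + k ≡ m → slope i ≡ i ∸ k
  slope-order i k refl = [m+n]∸[m+o]≡n∸o i i k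

  slope-killed : ∀ i k → suc i + k ≡ m → slope k ≡ k ∸ i
  slope-killed i k refl = trans (cong (k + k ∸_) (+-comm i k)) ([m+n]∸[m+o]≡n∸o k k i)

  GrowthAt : ℕ → Set
  GrowthAt n = ∀ j → j ≤ m → Bound (B n + slope j * n) (killed j n)

  -- The slope of `killed k n` is exactly what `exponent-balance` asks for. The surplus `i * suc i`
  -- vanishes only for `i = 0`, which later singles out `order 0` as the leading term.
  order-bound : ∀ i k n → suc i + k ≡ m → GrowthAt n →
                Bound (B (suc i + n) + (i ∸ k) * n + i * suc i) (order i (suc i + n))
  order-bound i k n e g with order-formula i k n e
  ... | U , _ , f = subst₂ Bound (exps e) (sym f)
        (bound-*ˡ U (bound-q^ (exponent i n) (g k (subst (k ≤_) e (m≤n+m k (suc i))))))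
    where
    exps : suc i + k ≡ m → B n + slope k * n + suc m * exponent i n ≡ B (suc i + n) + (i ∸ k) * n + i * suc i
    exps refl = trans (cong (λ x → B n + x * n + suc m * exponent i n) (slope-killed i k refl)) (sym (exponent-balance i k n))

  -- Measuring the slope in dimension `suc i + n′` instead of `n′` costs `(i ∸ k) * suc i`, which
  -- the surplus `i * suc i` covers.
  order-bound-slope : ∀ i n → i < m → (∀ n′ → n′ < n → GrowthAt n′) → Bound (B n + slope i * n) (order i n)
  order-bound-slope i n i<m g with <-≤-connex i n
  ... | inj₂ n≤i = subst (Bound _) (sym (order-small n≤i i<m)) (bound-0 _)
  ... | inj₁ i<n = subst (λ x → Bound (B x + slope i * x) (order i x)) (m+[n∸m]≡n i<n)
        (bound-weaken enough (order-bound i k n′ e (g n′ (subst (n′ <_) (m+[n∸m]≡n i<n) (s≤s (m≤n+m n′ i))))))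
    where
    n′ = n ∸ suc i
    k = m ∸ suc i
    e : suc i + k ≡ m
    e = m+[n∸m]≡n i<m
    enough : B (suc i + n′) + slope i * (suc i + n′) ≤ B (suc i + n′) + (i ∸ k) * n′ + i * suc i
    enough = begin
      B (suc i + n′) + slope i * (suc i + n′)                ≡⟨ cong (λ x → B (suc i + n′) + x * (suc i + n′)) (slope-order i k e) ⟩
      B (suc i + n′) + (i ∸ k) * (suc i + n′)                ≡⟨ lemma (B (suc i + n′)) (i ∸ k) (suc i) n′ ⟩
      B (suc i + n′) + (i ∸ k) * n′ + (i ∸ k) * suc i        ≤⟨ +-monoʳ-≤ _ (*-monoˡ-≤ (suc i) (m∸n≤m i k)) ⟩
      B (suc i + n′) + (i ∸ k) * n′ + i * suc i              ∎
      where
      open ≤-Reasoning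
      lemma : ∀ b d s n → b + d * (s + n) ≡ b + d * n + d * s
      lemma = solve-∀

  killed-grows : ∀ n → (∀ i → i < m → Bound (B n) (order i n)) →
                 ∀ j → j ≤ m → ∃ λ S → killed j n ≡ nilpotents n + S × Bound (B n) S
  killed-grows n b zero    _   = 0 , trans (killed-zero n) (sym (+-identityʳ _)) , bound-0 (B n)
  killed-grows n b (suc j) j<m with killed-grows n b j (<⇒≤ j<m)
  ... | S , e , s = S + order j n , trans (killed-suc j n) (trans (cong (_+ order j n) e) (+-assoc (nilpotents n) S _)) , bound-+ s (b j j<m)

  nilpotents-quotient : ∀ n S → killed m n ≡ nilpotents n + S → S ≡ (q ^ n ∸ 1) * nilpotents n
  nilpotents-quotient n S e = +-cancelˡ-≡ (nilpotents n) S _ (begin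
    nilpotents n + S                           ≡⟨ e ⟨
    killed m n                                 ≡⟨ killed-full n ⟩
    nilpotents n * q ^ n                       ≡⟨ *-comm (nilpotents n) _ ⟩
    q ^ n * nilpotents n                       ≡⟨ cong (_* nilpotents n) (m+[n∸m]≡n (m^n>0 q n)) ⟨
    (1 + (q ^ n ∸ 1)) * nilpotents n           ∎)
    where open ≡-Reasoning

  killed-top : ∀ n → Bound (B n) (nilpotents n) → Bound (B n + suc m * n) (killed m n)
  killed-top n b = subst (Bound _) (sym (trans (killed-full n) (*-comm (nilpotents n) _))) (bound-q^ n b)

  growth : ∀ n → GrowthAt n
  growth = <-rec GrowthAt step
    where
    step : ∀ n → (∀ {n′} → n′ < n → GrowthAt n′) → GrowthAt n
    -- Dimension 0 is separate because `q ^ 0 ∸ 1` is not a unit at p; the bound there is 0.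
    step zero _ j _ = 0 , 1∣ _ , ≤-reflexive (zeros v m-1 (slope j) m)
      where
      zeros : ∀ v a s m → v * (a * 0 + s * 0) ≡ suc m * 0
      zeros = solve-∀
    step n@(suc n-1) g j j≤m = down (m ∸ j) j (m∸n+n≡m j≤m)
      where
      g′ : ∀ n′ → n′ < n → GrowthAt n′
      g′ n′ = g
      nil : Bound (B n) (nilpotents n)
      nil with killed-grows n (λ i i<m → bound-weaken (m≤m+n (B n) _) (order-bound-slope i n i<m g′)) m ≤-refl
      ... | S , e , s = bound-unit (p∤q^-1 n-1) (subst (Bound (B n)) (nilpotents-quotient n S e) s)
      slope≤ : ∀ j → j ≤ m → slope j ≤ suc m
      slope≤ j j≤m = m≤n+o⇒m∸n≤o (suc (j + j)) m (begin
        suc (j + j)     ≤⟨ s≤s (+-mono-≤ j≤m j≤m) ⟩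
        suc (m + m)     ≡⟨ +-suc m m ⟨
        m + suc m       ∎)
        where open ≤-Reasoning
      -- Downwards from `j = m`, where `killed m` is `nilpotents` times `q ^ n`: each `killed j` is
      -- `killed (suc j)` minus `order j`, and both have at least the slope of `j`.
      down : ∀ k j → k + j ≡ m → Bound (B n + slope j * n) (killed j n)
      down zero    j refl = bound-weaken (+-monoʳ-≤ (B n) (*-monoˡ-≤ n (slope≤ m ≤-refl))) (killed-top n nil)
      down (suc k) j e = bound-∸ (subst (Bound _) (killed-suc j n)
          (bound-weaken (+-monoʳ-≤ (B n) (*-monoˡ-≤ n (∸-monoˡ-≤ m (s≤s (+-mono-≤ (n≤1+n j) (n≤1+n j))))))
            (down k (suc j) (trans (+-suc k j) e))))
        (order-bound-slope j n (subst (suc j ≤_) e (s≤s (m≤n+m j k))) g′)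

  nilpotents-bound : ∀ n → Bound (B n) (nilpotents n)
  nilpotents-bound n = subst (Bound (B n)) (killed-zero n) (bound-weaken (m≤m+n (B n) _) (growth n 0 z≤n))

  -- For a positive index the surplus of `order-bound` is positive.
  order-strict : ∀ i n → suc i < m → Strict (B n) (order (suc i) n)
  order-strict i n i<m with <-≤-connex (suc i) n
  ... | inj₂ n≤i = subst (Strict _) (sym (order-small n≤i i<m)) (strict-of-bound 0<v (n<1+n (B n)) (bound-0 _))
  ... | inj₁ i<n = subst (λ x → Strict (B x) (order (suc i) x)) (m+[n∸m]≡n i<n)
        (strict-of-bound 0<v
          (≤-<-trans (m≤m+n (B (suc (suc i) + n′)) ((suc i ∸ k) * n′)) (m<m+n _ (s≤s z≤n)))
          (order-bound (suc i) k n′ (m+[n∸m]≡n i<m) (growth n′)))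
    where
    n′ = n ∸ suc (suc i)
    k = m ∸ suc (suc i)

  -- The differences add up to `(q ^ suc n ∸ 1) * nilpotents (suc n)`. All but `order 0` are
  -- strictly more divisible, and `order 0 (suc n)` is a unit times `killed m-1 n`.
  sharp-rises : ∀ n → Sharp (B (suc n)) (killed m-1 n) → Sharp (B (suc n)) (nilpotents (suc n))
  sharp-rises n s with rise m-1 ≤-refl
    where
    first : Sharp (B (suc n)) (order 0 (suc n))
    first with order-formula 0 m-1 n refl
    ... | U , p∤U , e = subst (Sharp _) (sym (trans e (cong (U *_) (*-identityˡ _)))) (sharp-*-unit p∤U s)
    rise : ∀ j → suc j ≤ m → ∃ λ S → killed (suc j) (suc n) ≡ nilpotents (suc n) + S × Sharp (B (suc n)) S
    rise zero    _   = order 0 (suc n) , trans (killed-suc 0 (suc n)) (cong (_+ order 0 (suc n)) (killed-zero (suc n))) , first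
    rise (suc j) j<m with rise j (<⇒≤ j<m)
    ... | S , e , t = S + order (suc j) (suc n)
        , trans (killed-suc (suc j) (suc n)) (trans (cong (_+ order (suc j) (suc n)) e) (+-assoc (nilpotents (suc n)) S _))
        , sharp-+ t (order-strict j (suc n) j<m)
  ... | S , e , t = sharp-unit (p∤q^-1 n) (subst (Sharp _) (nilpotents-quotient (suc n) S e) t)

  -- `killed m-1` and `order m-1` in dimension `m + n` add up to `killed m`, which is too divisible
  -- to matter. So `killed m-1` inherits sharpness from `order m-1`, a unit times a power of q times
  -- `nilpotents n`; `sharp-rises` adds the last dimension.
  sharp-step : ∀ n → Sharp (B n) (nilpotents n) → Sharp (B (suc (m + n))) (nilpotents (suc (m + n)))
  sharp-step n s = sharp-rises (m + n) (sharp-∸ (sym (killed-suc m-1 (m + n))) last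
      (strict-of-bound 0<v below (killed-top (m + n) (nilpotents-bound (m + n)))))
    where
    last : Sharp (B (suc (m + n))) (order m-1 (m + n))
    last with order-formula m-1 0 n (cong suc (+-identityʳ m-1))
    ... | U , p∤U , e = subst₂ Sharp exps (sym e) (sharp-*-unit p∤U (sharp-q^ (exponent m-1 n) (subst (Sharp (B n)) (sym (killed-zero n)) s)))
      where
      open ≡-Reasoning
      -- At `i = m-1`, `k = 0` the surplus is `m-1 * (m + n)`, exactly the growth of `B` from
      -- `m + n` to `suc (m + n)`. This match produces the period `suc m`.
      exps : B n + suc m * exponent m-1 n ≡ B (suc (m + n))
      exps = begin
        B n + suc m * exponent m-1 n                            ≡⟨ cong (_+ suc m * exponent m-1 n) (+-identityʳ (B n)) ⟨
        B n + 0 + suc m * exponent m-1 n                        ≡⟨ balance ⟩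
        B (m + n) + m-1 * n + m-1 * m                           ≡⟨ collect m-1 n (triangle (m + n)) ⟩
        B (suc (m + n))                                         ∎
        where
        balance : B n + 0 + suc m * exponent m-1 n ≡ B (m + n) + m-1 * n + m-1 * m
        balance = sym (subst₂ (λ a z → a * triangle (m + n) + m-1 * n + m-1 * m ≡ a * triangle n + z * n + suc (suc a) * exponent m-1 n)
          (+-identityʳ m-1) (0∸n≡0 m-1) (exponent-balance m-1 0 n))
        collect : ∀ a n t → a * t + a * n + a * suc a ≡ a * (suc a + n + t)
        collect = solve-∀
    -- `B` grows by `m-1 * (m + n)` in this step, while `q ^ (m + n)` contributes `suc m * (m + n)`.
    below : B (suc (m + n)) < B (m + n) + suc m * (m + n)
    below = begin-strict
      B (suc (m + n))                            ≡⟨ trans (*-distribˡ-+ m-1 (m + n) _) (+-comm (m-1 * (m + n)) _) ⟩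
      B (m + n) + m-1 * (m + n)                  <⟨ +-monoʳ-< (B (m + n)) (*-monoˡ-< (m + n) (≤-trans (n<1+n m-1) (n≤1+n m))) ⟩
      B (m + n) + suc m * (m + n)                ∎
      where open ≤-Reasoning

  opaque
    unfolding nilpotents

    killed-0 : ∀ j → killed j 0 ≡ 1
    killed-0 zero    = trans (killed-zero 0) (trans (count-all (λ N → N ^ᴹ m ≐? 𝟎) (λ N → M₀≐𝟎 (N ^ᴹ m)) (Enum.elems (matᴱ 0 0))) (card-matᴱ 0 0))
    killed-0 (suc j) = trans (killed-suc j 0) (cong₂ _+_ (killed-0 j) (order-0 j))

    nilpotents>0 : ∀ n → 0 < nilpotents n
    nilpotents>0 n = filter-some _ (Any.map (λ e → 𝟎-∙ _ (≐-sym e))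
      (count≡1⇒Any (𝟎 ≐?_) (Enum.elems (matᴱ n n)) (Enum.once (matᴱ n n) 𝟎)))

  sharp-1 : ∀ {E} → E ≡ 0 → Sharp E 1
  sharp-1 refl = 0 , 1 , refl , (λ d → <⇒≱ 1<p (∣⇒≤ d)) , trans (*-zeroʳ (suc m)) (sym (*-zeroʳ v))

  sharp-periodic : ∀ n → Sharp (B n) (nilpotents n) → ∀ k → Sharp (B (n + k * suc m)) (nilpotents (n + k * suc m))
  sharp-periodic n s zero    = subst (λ x → Sharp (B x) (nilpotents x)) (sym (+-identityʳ n)) s
  sharp-periodic n s (suc k) = subst (λ x → Sharp (B x) (nilpotents x)) (lemma m n (k * suc m)) (sharp-step _ (sharp-periodic n s k))
    where
    lemma : ∀ m n a → suc (m + (n + a)) ≡ n + (suc m + a)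
    lemma = solve-∀

  sharp-0 : Sharp (B 0) (nilpotents 0)
  sharp-0 = subst (Sharp (B 0)) (sym (trans (sym (killed-zero 0)) (killed-0 0))) (sharp-1 (*-zeroʳ m-1))

  -- Dimension 1 rises from dimension 0, where each `killed j` is 1; so the two residues 0 and 1
  -- share one origin.
  sharp-one : Sharp (B 1) (nilpotents 1)
  sharp-one = sharp-rises 0 (subst (Sharp (B 1)) (sym (killed-0 m-1)) (sharp-1 (*-zeroʳ m-1)))

  sharp-mod : ∀ n → n % suc m ≡ 0 ⊎ n % suc m ≡ 1 → Sharp (B n) (nilpotents n)
  sharp-mod n e = subst (λ x → Sharp (B x) (nilpotents x)) (sym (m≡m%n+[m/n]*n n (suc m))) (sharp-periodic _ (base e) (n / suc m))
    where
    base : ∀ {r} → r ≡ 0 ⊎ r ≡ 1 → Sharp (B r) (nilpotents r)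
    base (inj₁ refl) = sharp-0
    base (inj₂ refl) = sharp-one

triangle≡C : ∀ n → triangle n ≡ n C 2
triangle≡C zero    = refl
triangle≡C (suc n) = trans (cong₂ _+_ (sym (nC1≡n n)) (triangle≡C n)) (nCk+nC[k+1]≡[n+1]C[k+1] n 1)

theorem3p4 : (p u v : ℕ) → Prime p → 1 ≤ v → (F : FieldOn (p ^ v)) → (n : ℕ)
    → let N = Matrices.numHom F (p ^ u) n in
    (v * (p ^ u ∸ 1) * (n C 2) ≤ (p ^ u + 1) * vp p N)
    × ((n % (1 + p ^ u) ≡ 0 ⊎ n % (1 + p ^ u) ≡ 1)
    → (p ^ u + 1) * vp p N ≡ v * (p ^ u ∸ 1) * (n C 2))
theorem3p4 p u v pr 1≤v F n = go (p ^ u) (pred (p ^ u)) (sym (suc-pred (p ^ u) {{m^n≢0 p u {{prime⇒nonZero pr}}}}))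
    (Characteristic.numHom≡nilpotents {p} {v} pr F u n)
  where
  -- The power `p ^ u` is replaced by a variable so that it can be matched against `suc m-1`.
  go : ∀ m m-1 → m ≡ suc m-1 → (∀ {k} → m ≡ suc k → Matrices.numHom F m n ≡ NilpotentCounts.nilpotents F k n) →
    let N = Matrices.numHom F m n in
    (v * (m ∸ 1) * (n C 2) ≤ (m + 1) * vp p N)
    × ((n % (1 + m) ≡ 0 ⊎ n % (1 + m) ≡ 1) → (m + 1) * vp p N ≡ v * (m ∸ 1) * (n C 2))
  go m m-1 refl count≡ = conclude (count≡ refl) (+-comm m 1)
      (trans (*-assoc v m-1 (n C 2)) (cong (λ t → v * (m-1 * t)) (sym (triangle≡C n))))
    where
    open Growth pr v 1≤v F m-1
    open Valuation pr v m
    open NilpotentCounts F m-1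
    conclude : ∀ {N M E} → N ≡ nilpotents n → M ≡ suc m → E ≡ v * B n →
               (E ≤ M * vp p N) × (n % suc m ≡ 0 ⊎ n % suc m ≡ 1 → M * vp p N ≡ E)
    conclude refl refl refl = bound⇒vp (nilpotents>0 n) (nilpotents-bound n)
                            , λ r → sharp⇒vp (nilpotents>0 n) (sharp-mod n r)
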